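{- Let $1\le k\le n$ be integers. Then $$\sum_{\Pi}\mathrm{wt}(\Pi)=\frac1n\binom nk\prod_{i=n-k}^{n-2}\big(iX_i+(n-i)\big),$$ where the sum is over all final chains $\Pi$ of length $k$ in $NC_n$.
   Context: $NC_n$ is the lattice of noncrossing partitions of $\{1,\dots,n\}$, i.e. set partitions with no $i<j<k<\ell$ such that $i,k$ are in one block and $j,\ell$ in another, ordered by refinement ($\pi\le\pi'$ if each block of $\pi$ is contained in a block of $\pi'$); $\hat 1$ is the one-block partition and $\lessdot$ denotes the covering relation of $NC_n$. A final chain of length $k$ in $NC_n$ is a $k$-tuple $(\pi_{n-k},\dots,\pi_{n-1})$ of elements of $NC_n$ with $\pi_{n-k}\lessdot\cdots\lessdot\pi_{n-1}=\hat 1$. If $\rho\lessdot\pi$ in $NC_n$, then $\rho$ is obtained from $\pi$ by splitting one block $B$ of $\pi$ into two blocks $B_1,B_2$; we write $\rho\sqsubset\pi$ if $\{B_1,B_2\}$ is an interval partition of $B$, i.e. all elements of one of $B_1,B_2$ are smaller than all elements of the other. The weight of a final chain $\Pi=(\pi_{n-k},\dots,\pi_{n-1})$ is $$\mathrm{wt}(\Pi)=\prod_{\substack{n-k\le i\le n-2\\ \pi_i\not\sqsubset\pi_{i+1}}}X_i,$$ where the $X_i$ are commuting indeterminates. -}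

module Defs where

open import Data.Bool.Base using (if_then_else_)
import Data.Bool.Properties as Bool
open import Data.Empty using (⊥)
open import Data.Fin.Base using (Fin; _<_)
import Data.Fin.Properties as Fin
open import Data.Fin.Subset using (Subset; inside; outside; _∈_; _⊆_; _∪_; ⊤)
open import Data.Fin.Subset.Properties using (_∈?_; _⊆?_; ∈⊤)
open import Data.Integer.Base using (+_)
open import Data.List.Base
  using (List; []; _∷_; applyUpTo; cartesianProductWith; filter; foldr; map; mapMaybe)
import Data.List.Membership.Propositional as ∈L
import Data.List.Membership.Propositional.Properties as ∈L
import Data.List.Relation.Unary.All as AllL
import Data.List.Relation.Unary.Any as AnyL
import Data.List.Relation.Unary.Any.Properties as AnyL
open import Data.List.Relation.Unary.Unique.Propositional using (Unique)
import Data.List.Relation.Unary.AllPairs as AllPairs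
import Data.List.Relation.Unary.Unique.Propositional.Properties as Unique
open import Data.Maybe.Base using (Maybe; just; nothing)
import Data.Maybe.Relation.Unary.Any as AnyM
open import Data.Nat.Base using (ℕ; zero; suc; _∸_)
import Data.Nat.Base as ℕ
open import Data.Product.Base using (∃; _×_; _,_)
open import Data.Rational.Base as ℚ using (ℚ; 0ℚ; 1ℚ)
open import Data.Sum.Base using (_⊎_)
open import Data.Vec.Base using (Vec; []; _∷_; lookup; replicate)
open import Data.Vec.Properties using (≡-dec; lookup-replicate; ∷-injective)
open import Data.Vec.Relation.Unary.All as All using (All)
open import Data.Vec.Relation.Unary.Any as Any using (Any)
import Relation.Binary.Construct.NonStrictToStrict as Strict
open import Relation.Binary.Definitions using (DecidableEquality)
open import Relation.Binary.PropositionalEquality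
  using (_≡_; _≢_; refl; sym; trans; cong; subst)
open import Relation.Nullary using (¬_; Dec; does; yes; no)
open import Relation.Nullary.Negation.Core using (contradiction-irr)
open import Relation.Nullary.Decidable
  using (map′; ¬?; _×-dec_; _⊎-dec_; _→-dec_)

private
  variable
    A : Set
    n k : ℕ

-- The polynomial ring ℚ[X₀, X₁, …], as the free commutative ℚ-algebra on
-- the indeterminates X i: terms modulo the congruence _≈_.

infixl 6 _+ₚ_
infixl 7 _*ₚ_
infix  4 _≈_

data ℚ[X] : Set where
  con  : ℚ → ℚ[X]
  X    : ℕ → ℚ[X]
  _+ₚ_ : ℚ[X] → ℚ[X] → ℚ[X]
  _*ₚ_ : ℚ[X] → ℚ[X] → ℚ[X]

data _≈_ : ℚ[X] → ℚ[X] → Set where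
  ≈-refl  : ∀ {p} → p ≈ p
  ≈-sym   : ∀ {p q} → p ≈ q → q ≈ p
  ≈-trans : ∀ {p q r} → p ≈ q → q ≈ r → p ≈ r

  +ₚ-cong : ∀ {p p′ q q′} → p ≈ p′ → q ≈ q′ → p +ₚ q ≈ p′ +ₚ q′
  *ₚ-cong : ∀ {p p′ q q′} → p ≈ p′ → q ≈ q′ → p *ₚ q ≈ p′ *ₚ q′

  +ₚ-assoc     : ∀ p q r → (p +ₚ q) +ₚ r ≈ p +ₚ (q +ₚ r)
  +ₚ-comm      : ∀ p q → p +ₚ q ≈ q +ₚ p
  +ₚ-identityˡ : ∀ p → con 0ℚ +ₚ p ≈ p

  *ₚ-assoc     : ∀ p q r → (p *ₚ q) *ₚ r ≈ p *ₚ (q *ₚ r)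
  *ₚ-comm      : ∀ p q → p *ₚ q ≈ q *ₚ p
  *ₚ-identityˡ : ∀ p → con 1ℚ *ₚ p ≈ p
  *ₚ-zeroˡ     : ∀ p → con 0ℚ *ₚ p ≈ con 0ℚ
  *ₚ-distribˡ  : ∀ p q r → p *ₚ (q +ₚ r) ≈ p *ₚ q +ₚ p *ₚ r

  con-+ : ∀ a b → con (a ℚ.+ b) ≈ con a +ₚ con b
  con-* : ∀ a b → con (a ℚ.* b) ≈ con a *ₚ con b

natₚ : ℕ → ℚ[X]
natₚ m = con (+ m ℚ./ 1)

∑ ∏ : List A → (A → ℚ[X]) → ℚ[X]
∑ xs f = foldr _+ₚ_ (con 0ℚ) (map f xs)
∏ xs f = foldr _*ₚ_ (con 1ℚ) (map f xs)

infix 5 ∑ ∏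
syntax ∑ xs (λ x → p) = ∑[ x ∈ xs ] p
syntax ∏ xs (λ x → p) = ∏[ x ∈ xs ] p

-- The integers a, a + 1, …, b ∸ 1.
[_⋯_⟩ : ℕ → ℕ → List ℕ
[ a ⋯ b ⟩ = applyUpTo (a ℕ.+_) (b ∸ a)

-- A set partition of Fin n is given by the vector whose entry at i is the block
-- containing i.  Each partition is encoded by exactly one such vector, and
-- its blocks are the entries of the vector (with repetitions).

IsPartition : Vec (Subset n) n → Set
IsPartition π =
    (∀ i → i ∈ lookup π i)
  × (∀ i j → j ∈ lookup π i → lookup π j ≡ lookup π i)

Noncrossing : Vec (Subset n) n → Set
Noncrossing π = ∀ i j k l → i < j → j < k → k < l →
  ¬ (k ∈ lookup π i × l ∈ lookup π j × lookup π i ≢ lookup π j)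

record NC (n : ℕ) : Set where
  constructor nc
  field
    blocks : Vec (Subset n) n
    .isNC  : IsPartition blocks × Noncrossing blocks

open NC public

infix 4 _≤ₙ_ _<ₙ_ _⋖_ _⊏_ _≪_

_≤ₙ_ : NC n → NC n → Set
π ≤ₙ π′ = All (λ B → Any (λ B′ → B ⊆ B′) (blocks π′)) (blocks π)

_<ₙ_ : NC n → NC n → Set
_<ₙ_ = Strict._<_ _≡_ _≤ₙ_

_⋖_ : NC n → NC n → Set
ρ ⋖ π = ρ <ₙ π × ¬ ∃ λ σ → ρ <ₙ σ × σ <ₙ π

1̂ : NC n
1̂ {n} = nc (replicate n ⊤)
  ( ( (λ i → subst (i ∈_) (sym (lookup-replicate i ⊤)) ∈⊤)
    , (λ i j _ → same j i) )
  , (λ i j _ _ _ _ _ (_ , _ , i≢j) → i≢j (same i j)) )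
  where
  same : ∀ i j → lookup (replicate n ⊤) i ≡ lookup (replicate n ⊤) j
  same i j = trans (lookup-replicate i ⊤) (sym (lookup-replicate j ⊤))

_≪_ : Subset n → Subset n → Set
B₁ ≪ B₂ = ∀ x y → x ∈ B₁ → y ∈ B₂ → x < y

-- Two distinct blocks of ρ have a block of π as their union only if that
-- block is the one split in passing from π to ρ.
_⊏_ : NC n → NC n → Set
ρ ⊏ π = ρ ⋖ π
  × Any (λ B → Any (λ B₁ → Any (λ B₂ →
      B₁ ≢ B₂ × B₁ ∪ B₂ ≡ B × (B₁ ≪ B₂ ⊎ B₂ ≪ B₁))
      (blocks ρ)) (blocks ρ)) (blocks π)

-- The entries of Π : Vec (NC n) k are π_{n-k}, …, π_{n-1}.

IsFinalChain : Vec (NC n) k → Set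
IsFinalChain []          = ⊥
IsFinalChain (π ∷ [])    = π ≡ 1̂
IsFinalChain (ρ ∷ π ∷ Π) = ρ ⋖ π × IsFinalChain (π ∷ Π)

vectors : List A → ∀ k → List (Vec A k)
vectors xs zero    = [] ∷ []
vectors xs (suc k) = cartesianProductWith _∷_ xs (vectors xs k)

∈-vectors : ∀ {xs : List A} → (∀ x → x ∈L.∈ xs) →
            (v : Vec A k) → v ∈L.∈ vectors xs k
∈-vectors all []      = AnyL.here refl
∈-vectors all (x ∷ v) = ∈L.∈-cartesianProductWith⁺ _∷_ (all x) (∈-vectors all v)

vectors-unique : ∀ {xs : List A} → Unique xs → ∀ k → Unique (vectors xs k)
vectors-unique xs! zero    = AllL.[] AllPairs.∷ AllPairs.[]
vectors-unique xs! (suc k) =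
  Unique.cartesianProductWith⁺ _∷_ ∷-injective xs! (vectors-unique xs! k)

subsets : ∀ n → List (Subset n)
subsets = vectors (inside ∷ outside ∷ [])

∈-subsets : (B : Subset n) → B ∈L.∈ subsets n
∈-subsets = ∈-vectors λ where
  inside  → AnyL.here refl
  outside → AnyL.there (AnyL.here refl)

subsets-unique : ∀ n → Unique (subsets n)
subsets-unique = vectors-unique
  (((λ ()) AllL.∷ AllL.[]) AllPairs.∷ AllL.[] AllPairs.∷ AllPairs.[])

_≟ₛ_ : DecidableEquality (Subset n)
_≟ₛ_ = ≡-dec Bool._≟_

isNC? : (π : Vec (Subset n) n) → Dec (IsPartition π × Noncrossing π)
isNC? π = (in-block ×-dec same-block) ×-dec noncrossing
  where
  in-block = Fin.all? λ i → i ∈? lookup π i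
  same-block = Fin.all? λ i → Fin.all? λ j →
    j ∈? lookup π i →-dec lookup π j ≟ₛ lookup π i
  noncrossing = Fin.all? λ i → Fin.all? λ j → Fin.all? λ k → Fin.all? λ l →
    i Fin.<? j →-dec (j Fin.<? k →-dec (k Fin.<? l →-dec
      ¬? (k ∈? lookup π i ×-dec l ∈? lookup π j
          ×-dec ¬? (lookup π i ≟ₛ lookup π j))))

fromDec : (π : Vec (Subset n) n) → Dec (IsPartition π × Noncrossing π) → Maybe (NC n)
fromDec π (yes p) = just (nc π p)
fromDec π (no _)  = nothing

allNC : ∀ n → List (NC n)
allNC n = mapMaybe (λ π → fromDec π (isNC? π)) (vectors (subsets n) n)

∈-allNC : (π : NC n) → π ∈L.∈ allNC n
∈-allNC (nc π p) = AnyL.mapMaybe⁺ (λ π → fromDec π (isNC? π)) _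
  (AnyL.map⁺ (AnyL.map (λ { refl → just-fromDec (isNC? π) })
    (∈-vectors ∈-subsets π)))
  where
  just-fromDec : (p? : Dec (IsPartition π × Noncrossing π)) →
                 AnyM.Any (nc π p ≡_) (fromDec π p?)
  just-fromDec (yes _) = AnyM.just refl
  just-fromDec (no ¬p) = contradiction-irr p ¬p

allNC-unique : ∀ n → Unique (allNC n)
allNC-unique n = Unique.map⁻ (subst Unique (sym (map-blocks isNC? (vectors (subsets n) n)))
  (Unique.filter⁺ isNC? (vectors-unique (subsets-unique n) n)))
  where
  map-blocks : (p? : (π : Vec (Subset n) n) → Dec (IsPartition π × Noncrossing π)) →
               ∀ πs → map blocks (mapMaybe (λ π → fromDec π (p? π)) πs) ≡ filter p? πs
  map-blocks p? []       = refl
  map-blocks p? (π ∷ πs) with p? π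
  ... | yes _ = cong (π ∷_) (map-blocks p? πs)
  ... | no  _ = map-blocks p? πs

infix 4 _≟ₙ_ _≤ₙ?_ _<ₙ?_ _⋖?_ _⊏?_ _≪?_

_≟ₙ_ : DecidableEquality (NC n)
nc π _ ≟ₙ nc π′ _ = map′ (λ { refl → refl }) (cong blocks) (π ≟ₛₛ π′)
  where
  _≟ₛₛ_ = ≡-dec _≟ₛ_

_≤ₙ?_ : (π π′ : NC n) → Dec (π ≤ₙ π′)
π ≤ₙ? π′ = All.all? (λ B → Any.any? (λ B′ → B ⊆? B′) (blocks π′)) (blocks π)

_<ₙ?_ : (π π′ : NC n) → Dec (π <ₙ π′)
_<ₙ?_ = Strict.<-decidable _≡_ _≤ₙ_ _≟ₙ_ _≤ₙ?_

_⋖?_ : (ρ π : NC n) → Dec (ρ ⋖ π)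
_⋖?_ {n} ρ π = ρ <ₙ? π ×-dec ¬? (map′ AnyL.satisfied
  (λ (σ , p) → ∈L.lose (∈-allNC σ) p)
  (AnyL.any? (λ σ → ρ <ₙ? σ ×-dec σ <ₙ? π) (allNC n)))

_≪?_ : (B₁ B₂ : Subset n) → Dec (B₁ ≪ B₂)
B₁ ≪? B₂ = Fin.all? λ x → Fin.all? λ y →
  x ∈? B₁ →-dec (y ∈? B₂ →-dec x Fin.<? y)

_⊏?_ : (ρ π : NC n) → Dec (ρ ⊏ π)
ρ ⊏? π = ρ ⋖? π
  ×-dec Any.any? (λ B → Any.any? (λ B₁ → Any.any? (λ B₂ →
      ¬? (B₁ ≟ₛ B₂) ×-dec (B₁ ∪ B₂) ≟ₛ B ×-dec (B₁ ≪? B₂ ⊎-dec B₂ ≪? B₁))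
      (blocks ρ)) (blocks ρ)) (blocks π)

isFinalChain? : (Π : Vec (NC n) k) → Dec (IsFinalChain Π)
isFinalChain? []          = no λ ()
isFinalChain? (π ∷ [])    = π ≟ₙ 1̂
isFinalChain? (ρ ∷ π ∷ Π) = ρ ⋖? π ×-dec isFinalChain? (π ∷ Π)

finalChains : ∀ n k → List (Vec (NC n) k)
finalChains n k = filter isFinalChain? (vectors (allNC n) k)

∈-finalChains : {Π : Vec (NC n) k} → IsFinalChain Π → Π ∈L.∈ finalChains n k
∈-finalChains {Π = Π} = ∈L.∈-filter⁺ isFinalChain? (∈-vectors ∈-allNC Π)

finalChains-unique : ∀ n k → Unique (finalChains n k)
finalChains-unique n k =
  Unique.filter⁺ isFinalChain? (vectors-unique (allNC-unique n) k)

-- The tail of a final chain of length k is a final chain of length k ∸ 1,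
-- so the head ρ of a chain of length k is always π_{n-k}.
wt : Vec (NC n) k → ℚ[X]
wt []                          = con 1ℚ
wt (π ∷ [])                    = con 1ℚ
wt {n} {k} (ρ ∷ π ∷ Π) =
  (if does (ρ ⊏? π) then con 1ℚ else X (n ∸ k)) *ₚ wt (π ∷ Π)

{-# OPTIONS --safe #-}

-- If final chains are taken with their weights and the blocks of π_{n-k} are put
-- in random order, the sizes of these blocks are uniformly distributed over the
-- compositions of n into k parts: for every symmetric function f of the block
-- sizes, k Σ_Π wt(Π) f(π_{n-k}) is the product of the factors i X_i + (n - i),
-- n - k ≤ i ≤ n - 2, times the sum of f over the compositions; f = 1 gives the
-- theorem.  The induction step goes from π = π_{i+1} to its lower covers: a block
-- of size b is cut into parts of sizes c and a = b - c, the second one lying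
-- between elements of the first or at its end, with total weight 1 + (c - 1) X_i.
-- Summing over all compositions, the part of size c may be any of the parts of
-- the finer composition, and all these have the same mean size, so that the
-- weight can be replaced by its mean, which is a multiple of i X_i + (n - i).

module Submission where

open import Defs
open import Algebra.Bundles using (CommutativeSemiring)
open import Algebra.Structures.Biased using (isCommutativeSemiringˡ)
open import Data.Bool.Base using (Bool; true; false; if_then_else_; _∧_)
open import Data.Bool.Properties using (∧-identityʳ; ∧-zeroʳ)
open import Data.Fin.Base using (Fin; zero; suc; toℕ; _≤_; _<_)
open import Data.Fin.Properties
  using (toℕ-injective; suc-injective; _≟_; _≤?_; _<?_; all?; any?; ¬∀⟶∃¬)
open import Data.Fin.Subset using (Subset; ⊤; _⊆_; _∪_) renaming (_∈_ to _∈ₛ_)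
open import Data.Fin.Subset.Properties using (_∈?_; ∈⊤; ⊆-antisym; x∈p∪q⁺; x∈p∪q⁻)
open import Data.Integer.Base as ℤ using (+_)
import Data.Integer.Properties as ℤ
open import Data.List.Base as List
  using (List; []; _∷_; _++_; map; concatMap; filter; cartesianProductWith;
         length; allFin; downFrom; applyUpTo)
open import Data.List.Properties
  using (filter-all; filter-none; filter-accept; filter-reject; length-++; length-tabulate)
open import Data.List.Membership.Propositional using (_∈_; _∉_; find; lose)
open import Data.List.Membership.Propositional.Properties
  using (∈-filter⁺; ∈-filter⁻; ∈-allFin; ∈-++⁺ˡ; ∈-++⁺ʳ; ∈-++⁻; ∈-map⁺; ∈-map⁻;
         ∈-concatMap⁺; ∈-concatMap⁻; ∈-downFrom⁻; ∈-tabulate⁺; ∈-tabulate⁻)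
open import Data.List.Membership.Propositional.Properties.WithK using (unique∧set⇒bag)
open import Data.List.Relation.Binary.BagAndSetEquality using (∼bag⇒↭)
open import Data.List.Relation.Binary.Permutation.Propositional as ↭
  using (_↭_; ↭-refl; ↭-trans; ↭-reflexive)
open import Data.List.Relation.Binary.Permutation.Propositional.Properties
  using (↭-length) renaming (map⁺ to ↭-map⁺)
import Data.List.Relation.Unary.All as AllL
import Data.List.Relation.Unary.All.Properties as AllL
open import Data.List.Relation.Unary.AllPairs using (AllPairs; []; _∷_)
import Data.List.Relation.Unary.AllPairs.Properties as AllPairs
open import Data.List.Relation.Unary.Any as AnyL using (here; there)
open import Data.List.Relation.Unary.Unique.Propositional using (Unique)
import Data.List.Relation.Unary.Unique.Propositional.Properties as Unique
open import Data.Nat.Base as ℕ using (ℕ; zero; suc; _+_; _*_; _∸_; NonZero; z≤n; s≤s)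
open import Data.Nat.Combinatorics using (_C_; nC1≡n; nCn≡1; nCk+nC[k+1]≡[n+1]C[k+1])
open import Data.Nat.ListAction using (sum)
import Data.Nat.Properties as ℕ
open import Data.Product.Base using (∃; ∃₂; _×_; _,_; proj₁; proj₂)
open import Data.Rational.Base as ℚ using (0ℚ; 1ℚ; _/_)
import Data.Rational.Properties as ℚ
import Data.Rational.Unnormalised.Base as ℚᵘ
import Data.Rational.Unnormalised.Properties as ℚᵘ
open import Data.Sum.Base as Sum using (_⊎_; inj₁; inj₂; [_,_]; [_,_]′)
open import Data.Vec.Base as Vec using (Vec; []; _∷_; lookup; tabulate)
open import Data.Vec.Properties
  using (lookup∘tabulate; tabulate∘lookup; tabulate-cong; lookup-replicate; []=⇒lookup; lookup⇒[]=)
import Data.Vec.Relation.Unary.All.Properties as All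
open import Data.Vec.Relation.Unary.Any as Any using (Any)
import Data.Vec.Relation.Unary.Any.Properties as Any
open import Function.Base using (_∘_; _$_; id)
open import Function.Bundles using (mk⇔)
open import Relation.Binary.PropositionalEquality
  using (_≡_; _≢_; refl; sym; trans; cong; cong₂; subst; module ≡-Reasoning)
open import Relation.Binary.Structures using (IsEquivalence)
open import Relation.Nullary using (¬_; Dec; does; yes; no; contradiction; recompute)
open import Relation.Nullary.Decidable
  using (_×-dec_; _→-dec_; ¬?; map′; decidable-stable; dec-true; dec-false)
open import Relation.Unary using (Decidable)

-- The total weight of the lower covers of a partition depends on its block sizes and not only on
-- their number, so chains cannot be counted step by step with a constant factor. A distribution of
-- the sizes has to be carried along, and the uniform one reproduces itself. The test functions are
-- symmetric because a cut gives the new blocks no canonical places among the old ones. The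
-- induction removes the finest entry of a chain. Summing over it turns `f` into `splits x f`, which
-- is again symmetric and is evaluated at the next entry; hence the hypothesis must hold for all `f`
-- at once. The factor k on the left comes from the passage from k to k + 1 parts: the choice of the
-- part to be cut gives a factor k, and the mean over the k + 1 new parts a denominator k + 1. These
-- quotients telescope to 1 / k, which is kept on the other side so that only natural numbers have
-- to be cancelled. At f = 1 there are (n - 1 choose k - 1) compositions, and n (n - 1 choose k - 1)
-- = k (n choose k) yields the coefficient of the theorem.

private
  variable
    A B : Set

-- Both sides count the (k + 1)-subsets of an (n + 1)-set with one marked element. The induction
-- uses Pascal's rule on each side.
absorption : ∀ n k → suc k * (suc n C suc k) ≡ suc n * (n C k)
absorption zero    zero    = refl
absorption zero    (suc k) = ℕ.*-zeroʳ (suc (suc k))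
absorption (suc n) zero    = trans (ℕ.*-identityˡ _)
  (trans (nC1≡n (suc (suc n))) (sym (ℕ.*-identityʳ (suc (suc n)))))
absorption (suc n) (suc k) = begin
  suc (suc k) * (suc (suc n) C suc (suc k))
    ≡⟨ cong (suc (suc k) *_) (nCk+nC[k+1]≡[n+1]C[k+1] (suc n) (suc k)) ⟨
  suc (suc k) * (c + (suc n C suc (suc k)))
    ≡⟨ ℕ.*-distribˡ-+ (suc (suc k)) c _ ⟩
  c + suc k * c + suc (suc k) * (suc n C suc (suc k))
    ≡⟨ cong₂ (λ a b → c + a + b) (absorption n k) (absorption n (suc k)) ⟩
  c + suc n * (n C k) + suc n * (n C suc k)
    ≡⟨ ℕ.+-assoc c _ _ ⟩
  c + (suc n * (n C k) + suc n * (n C suc k))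
    ≡⟨ cong (λ m → c + m) (ℕ.*-distribˡ-+ (suc n) (n C k) _) ⟨
  c + suc n * (n C k + n C suc k)
    ≡⟨ cong (λ m → c + suc n * m) (nCk+nC[k+1]≡[n+1]C[k+1] n k) ⟩
  suc (suc n) * c ∎
  where
  open ≡-Reasoning
  c : ℕ
  c = suc n C suc k

-- The polynomial ring and its natural constants

ℚ[X]-commutativeSemiring : CommutativeSemiring _ _
ℚ[X]-commutativeSemiring = record
  { Carrier = ℚ[X] ; _≈_ = _≈_ ; _+_ = _+ₚ_ ; _*_ = _*ₚ_ ; 0# = con 0ℚ ; 1# = con 1ℚ
  ; isCommutativeSemiring = isCommutativeSemiringˡ record
    { +-isCommutativeMonoid = record
      { isMonoid = record
        { isSemigroup = record
          { isMagma = record { isEquivalence = isEq ; ∙-cong = +ₚ-cong }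
          ; assoc   = +ₚ-assoc }
        ; identity = +ₚ-identityˡ , λ p → ≈-trans (+ₚ-comm p _) (+ₚ-identityˡ p) }
      ; comm = +ₚ-comm }
    ; *-isCommutativeMonoid = record
      { isMonoid = record
        { isSemigroup = record
          { isMagma = record { isEquivalence = isEq ; ∙-cong = *ₚ-cong }
          ; assoc   = *ₚ-assoc }
        ; identity = *ₚ-identityˡ , λ p → ≈-trans (*ₚ-comm p _) (*ₚ-identityˡ p) }
      ; comm = *ₚ-comm }
    ; distribʳ = λ p q r → ≈-trans (*ₚ-comm (q +ₚ r) p)
        (≈-trans (*ₚ-distribˡ p q r) (+ₚ-cong (*ₚ-comm p q) (*ₚ-comm p r)))
    ; zeroˡ = *ₚ-zeroˡ } }
  where
  isEq : IsEquivalence _≈_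
  isEq = record { refl = ≈-refl ; sym = ≈-sym ; trans = ≈-trans }

open CommutativeSemiring ℚ[X]-commutativeSemiring
  using (setoid; reflexive; +-congˡ; +-congʳ; *-congˡ; *-congʳ;
         +-identityʳ; *-identityʳ; zeroʳ; distribʳ; +-commutativeSemigroup; *-commutativeSemigroup)
open import Algebra.Properties.CommutativeSemigroup +-commutativeSemigroup
  using () renaming (interchange to +ₚ-interchange; x∙yz≈y∙xz to +ₚ-x∙yz≈y∙xz)
open import Algebra.Properties.CommutativeSemigroup *-commutativeSemigroup
  using () renaming (x∙yz≈y∙xz to *ₚ-x∙yz≈y∙xz)
open import Relation.Binary.Reasoning.Setoid setoid

0ₚ 1ₚ : ℚ[X]
0ₚ = con 0ℚ
1ₚ = con 1ℚ

/1-homo-+ : ∀ m n → + (m + n) / 1 ≡ (+ m / 1) ℚ.+ (+ n / 1)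
/1-homo-+ m n = ℚ.toℚᵘ-injective $ ℚᵘ.≃-trans (ℚ.toℚᵘ-fromℚᵘ (+ (m + n) ℚᵘ./ 1))
  (ℚᵘ.≃-sym (ℚᵘ.≃-trans (ℚ.toℚᵘ-homo-+ (+ m / 1) (+ n / 1))
    (ℚᵘ.≃-trans (ℚᵘ.+-cong (ℚ.toℚᵘ-fromℚᵘ (+ m ℚᵘ./ 1)) (ℚ.toℚᵘ-fromℚᵘ (+ n ℚᵘ./ 1)))
      (ℚᵘ.*≡* (cong (ℤ._* + 1) (cong₂ ℤ._+_ (ℤ.*-identityʳ (+ m)) (ℤ.*-identityʳ (+ n))))))))

/1-homo-* : ∀ m n → + (m * n) / 1 ≡ (+ m / 1) ℚ.* (+ n / 1)
/1-homo-* m n = ℚ.toℚᵘ-injective $ ℚᵘ.≃-trans (ℚ.toℚᵘ-fromℚᵘ (+ (m * n) ℚᵘ./ 1))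
  (ℚᵘ.≃-sym (ℚᵘ.≃-trans (ℚ.toℚᵘ-homo-* (+ m / 1) (+ n / 1))
    (ℚᵘ.≃-trans (ℚᵘ.*-cong (ℚ.toℚᵘ-fromℚᵘ (+ m ℚᵘ./ 1)) (ℚ.toℚᵘ-fromℚᵘ (+ n ℚᵘ./ 1)))
      (ℚᵘ.*≡* (cong (ℤ._* + 1) (sym (ℤ.pos-* m n)))))))

1/n*n≡1 : ∀ n .{{_ : NonZero n}} → (+ 1 / n) ℚ.* (+ n / 1) ≡ 1ℚ
1/n*n≡1 n@(suc _) = ℚ.toℚᵘ-injective $ ℚᵘ.≃-trans (ℚ.toℚᵘ-homo-* (+ 1 / n) (+ n / 1))
    (ℚᵘ.≃-trans (ℚᵘ.*-cong (ℚ.toℚᵘ-fromℚᵘ (+ 1 ℚᵘ./ n)) (ℚ.toℚᵘ-fromℚᵘ (+ n ℚᵘ./ 1)))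
      (ℚᵘ.*≡* (trans (ℤ.*-identityʳ _)
        (cong (λ m → + 1 ℤ.* + m) (sym (ℕ.*-identityʳ n))))))

natₚ-+ : ∀ m n → natₚ (m + n) ≈ natₚ m +ₚ natₚ n
natₚ-+ m n = ≈-trans (reflexive (cong con (/1-homo-+ m n))) (con-+ _ _)

natₚ-* : ∀ m n → natₚ (m * n) ≈ natₚ m *ₚ natₚ n
natₚ-* m n = ≈-trans (reflexive (cong con (/1-homo-* m n))) (con-* _ _)

natₚ-suc* : ∀ m p → natₚ (suc m) *ₚ p ≈ p +ₚ natₚ m *ₚ p
natₚ-suc* m p = begin
  natₚ (suc m) *ₚ p           ≈⟨ *-congʳ (natₚ-+ 1 m) ⟩
  (1ₚ +ₚ natₚ m) *ₚ p          ≈⟨ distribʳ p 1ₚ (natₚ m) ⟩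
  1ₚ *ₚ p +ₚ natₚ m *ₚ p       ≈⟨ +-congʳ (*ₚ-identityˡ p) ⟩
  p +ₚ natₚ m *ₚ p             ∎

-- Finite sums

∑-cong : ∀ {f g : A → ℚ[X]} xs → (∀ {x} → x ∈ xs → f x ≈ g x) → ∑ xs f ≈ ∑ xs g
∑-cong []       f≈g = ≈-refl
∑-cong (x ∷ xs) f≈g = +ₚ-cong (f≈g (here refl)) (∑-cong xs (f≈g ∘ there))

∑-++ : ∀ (f : A → ℚ[X]) xs ys → ∑ (xs ++ ys) f ≈ ∑ xs f +ₚ ∑ ys f
∑-++ f []       ys = ≈-sym (+ₚ-identityˡ _)
∑-++ f (x ∷ xs) ys = ≈-trans (+-congˡ (∑-++ f xs ys)) (≈-sym (+ₚ-assoc _ _ _))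

∑-map : ∀ (f : B → ℚ[X]) (g : A → B) xs → ∑ (map g xs) f ≈ ∑ xs (λ x → f (g x))
∑-map f g []       = ≈-refl
∑-map f g (x ∷ xs) = +-congˡ (∑-map f g xs)

∑-concatMap : ∀ (f : B → ℚ[X]) (g : A → List B) xs →
              ∑ (concatMap g xs) f ≈ ∑ xs (λ x → ∑ (g x) f)
∑-concatMap f g []       = ≈-refl
∑-concatMap f g (x ∷ xs) = ≈-trans (∑-++ f (g x) _) (+-congˡ (∑-concatMap f g xs))

∑-0 : ∀ (xs : List A) → ∑ xs (λ _ → 0ₚ) ≈ 0ₚ
∑-0 []       = ≈-refl
∑-0 (x ∷ xs) = ≈-trans (+ₚ-identityˡ _) (∑-0 xs)

∑-+ : ∀ (f g : A → ℚ[X]) xs → ∑ xs (λ x → f x +ₚ g x) ≈ ∑ xs f +ₚ ∑ xs g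
∑-+ f g []       = ≈-sym (+ₚ-identityˡ _)
∑-+ f g (x ∷ xs) = ≈-trans (+-congˡ (∑-+ f g xs)) (+ₚ-interchange _ _ _ _)

∑-*ˡ : ∀ p (f : A → ℚ[X]) xs → ∑ xs (λ x → p *ₚ f x) ≈ p *ₚ ∑ xs f
∑-*ˡ p f []       = ≈-sym (zeroʳ p)
∑-*ˡ p f (x ∷ xs) = ≈-trans (+-congˡ (∑-*ˡ p f xs)) (≈-sym (*ₚ-distribˡ _ _ _))

∑-swap : ∀ (f : A → B → ℚ[X]) xs ys →
         ∑ xs (λ x → ∑ ys (f x)) ≈ ∑ ys (λ y → ∑ xs (λ x → f x y))
∑-swap f []       ys = ≈-sym (∑-0 ys)
∑-swap f (x ∷ xs) ys = ≈-trans (+-congˡ (∑-swap f xs ys)) (≈-sym (∑-+ (f x) _ ys))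

∑-↭ : ∀ (f : A → ℚ[X]) {xs ys} → xs ↭ ys → ∑ xs f ≈ ∑ ys f
∑-↭ f ↭.refl           = ≈-refl
∑-↭ f (↭.prep x p)   = +-congˡ (∑-↭ f p)
∑-↭ f (↭.swap x y p) = ≈-trans (+-congˡ (+-congˡ (∑-↭ f p))) (+ₚ-x∙yz≈y∙xz _ _ _)
∑-↭ f (↭.trans p q)  = ≈-trans (∑-↭ f p) (∑-↭ f q)

∑-filter : ∀ {P : A → Set} (P? : Decidable P) (f : A → ℚ[X]) xs →
           ∑ (filter P? xs) f ≈ ∑ xs (λ x → if does (P? x) then f x else 0ₚ)
∑-filter P? f []       = ≈-refl
∑-filter P? f (x ∷ xs) with does (P? x)
... | true  = +-congˡ (∑-filter P? f xs)
... | false = ≈-trans (∑-filter P? f xs) (≈-sym (+ₚ-identityˡ _))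

∑-cartesianProductWith : ∀ {C : Set} (h : A → B → C) (f : C → ℚ[X]) xs ys →
  ∑ (cartesianProductWith h xs ys) f ≈ ∑ xs (λ x → ∑ ys (λ y → f (h x y)))
∑-cartesianProductWith h f []       ys = ≈-refl
∑-cartesianProductWith h f (x ∷ xs) ys = ≈-trans (∑-++ f (map (h x) ys) _)
  (+ₚ-cong (∑-map f (h x) ys) (∑-cartesianProductWith h f xs ys))

-- Weak compositions

-- The second list has total n - 1 because block sizes are lowered by one: cutting s + 1 elements
-- into c + 1 and a + 1 gives c + a = s - 1. It is empty at 0 since a singleton cannot be cut.
antidiagonal antidiagonal⁻ : ℕ → List (ℕ × ℕ)
antidiagonal zero    = (0 , 0) ∷ []
antidiagonal (suc n) = (0 , suc n) ∷ map (λ (p , q) → suc p , q) (antidiagonal n)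

antidiagonal⁻ zero    = []
antidiagonal⁻ (suc n) = antidiagonal n

∑ₐ ∑ₐ⁻ : ℕ → (ℕ → ℕ → ℚ[X]) → ℚ[X]
∑ₐ  n f = ∑ (antidiagonal  n) (λ (p , q) → f p q)
∑ₐ⁻ n f = ∑ (antidiagonal⁻ n) (λ (p , q) → f p q)

module _ {f g : ℕ → ℕ → ℚ[X]} where

  ∑ₐ-cong : ∀ n → (∀ p q → f p q ≈ g p q) → ∑ₐ n f ≈ ∑ₐ n g
  ∑ₐ-cong n f≈g = ∑-cong (antidiagonal n) (λ _ → f≈g _ _)

  ∑ₐ⁻-cong : ∀ n → (∀ p q → f p q ≈ g p q) → ∑ₐ⁻ n f ≈ ∑ₐ⁻ n g
  ∑ₐ⁻-cong n f≈g = ∑-cong (antidiagonal⁻ n) (λ _ → f≈g _ _)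

∑ₐ-suc : ∀ f n → ∑ₐ (suc n) f ≈ f 0 (suc n) +ₚ ∑ₐ n (λ p q → f (suc p) q)
∑ₐ-suc f n = +-congˡ (∑-map (λ (p , q) → f p q) (λ (p , q) → suc p , q) (antidiagonal n))

∑ₐ-suc′ : ∀ f n → ∑ₐ (suc n) f ≈ ∑ₐ n (λ p q → f p (suc q)) +ₚ f (suc n) 0
∑ₐ-suc′ f zero    = begin
  f 0 1 +ₚ (f 1 0 +ₚ 0ₚ)    ≈⟨ +-congˡ (+-identityʳ _) ⟩
  f 0 1 +ₚ f 1 0            ≈⟨ +-congʳ (+-identityʳ _) ⟨
  (f 0 1 +ₚ 0ₚ) +ₚ f 1 0    ∎
∑ₐ-suc′ f (suc n) = begin
  ∑ₐ (suc (suc n)) f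
    ≈⟨ ∑ₐ-suc f (suc n) ⟩
  f 0 (suc (suc n)) +ₚ ∑ₐ (suc n) (λ p q → f (suc p) q)
    ≈⟨ +-congˡ (∑ₐ-suc′ (λ p q → f (suc p) q) n) ⟩
  f 0 (suc (suc n)) +ₚ (∑ₐ n (λ p q → f (suc p) (suc q)) +ₚ f (suc (suc n)) 0)
    ≈⟨ +ₚ-assoc _ _ _ ⟨
  f 0 (suc (suc n)) +ₚ ∑ₐ n (λ p q → f (suc p) (suc q)) +ₚ f (suc (suc n)) 0
    ≈⟨ +-congʳ (∑ₐ-suc (λ p q → f p (suc q)) n) ⟨
  ∑ₐ (suc n) (λ p q → f p (suc q)) +ₚ f (suc (suc n)) 0 ∎

∑ₐ-comm : ∀ f n → ∑ₐ n f ≈ ∑ₐ n (λ p q → f q p)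
∑ₐ-comm f zero    = ≈-refl
∑ₐ-comm f (suc n) = begin
  ∑ₐ (suc n) f                                ≈⟨ ∑ₐ-suc f n ⟩
  f 0 (suc n) +ₚ ∑ₐ n (λ p q → f (suc p) q)   ≈⟨ +-congˡ (∑ₐ-comm (λ p q → f (suc p) q) n) ⟩
  f 0 (suc n) +ₚ ∑ₐ n (λ p q → f (suc q) p)   ≈⟨ +ₚ-comm _ _ ⟩
  ∑ₐ n (λ p q → f (suc q) p) +ₚ f 0 (suc n)   ≈⟨ ∑ₐ-suc′ (λ p q → f q p) n ⟨
  ∑ₐ (suc n) (λ p q → f q p)                  ∎

∑ₐ-assoc : ∀ (f : ℕ → ℕ → ℕ → ℚ[X]) n →
  ∑ₐ n (λ m r → ∑ₐ m (λ p q → f p q r)) ≈ ∑ₐ n (λ p m → ∑ₐ m (λ q r → f p q r))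
∑ₐ-assoc f zero    = ≈-refl
∑ₐ-assoc f (suc n) = begin
  ∑ₐ (suc n) (λ m r → ∑ₐ m (λ p q → f p q r))
    ≈⟨ ∑ₐ-suc (λ m r → ∑ₐ m (λ p q → f p q r)) n ⟩
  (f 0 0 (suc n) +ₚ 0ₚ) +ₚ ∑ₐ n (λ m r → ∑ₐ (suc m) (λ p q → f p q r))
    ≈⟨ +ₚ-cong (+-identityʳ _) (∑ₐ-cong n (λ m r → ∑ₐ-suc (λ p q → f p q r) m)) ⟩
  f 0 0 (suc n) +ₚ ∑ₐ n (λ m r → f 0 (suc m) r +ₚ ∑ₐ m (λ p q → f (suc p) q r))
    ≈⟨ +-congˡ (∑-+ _ _ (antidiagonal n)) ⟩
  f 0 0 (suc n) +ₚ (∑ₐ n (λ m r → f 0 (suc m) r) +ₚ ∑ₐ n (λ m r → ∑ₐ m (λ p q → f (suc p) q r)))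
    ≈⟨ +ₚ-assoc _ _ _ ⟨
  f 0 0 (suc n) +ₚ ∑ₐ n (λ m r → f 0 (suc m) r) +ₚ ∑ₐ n (λ m r → ∑ₐ m (λ p q → f (suc p) q r))
    ≈⟨ +ₚ-cong (≈-sym (∑ₐ-suc (f 0) n)) (∑ₐ-assoc (λ p q r → f (suc p) q r) n) ⟩
  ∑ₐ (suc n) (f 0) +ₚ ∑ₐ n (λ p m → ∑ₐ m (λ q r → f (suc p) q r))
    ≈⟨ ∑ₐ-suc (λ p m → ∑ₐ m (f p)) n ⟨
  ∑ₐ (suc n) (λ p m → ∑ₐ m (λ q r → f p q r)) ∎

∑ₐ-exchange : ∀ (f : ℕ → ℕ → ℕ → ℚ[X]) n →
  ∑ₐ n (λ p m → ∑ₐ m (λ q r → f p q r)) ≈ ∑ₐ n (λ p m → ∑ₐ m (λ q r → f q p r))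
∑ₐ-exchange f n = begin
  ∑ₐ n (λ p m → ∑ₐ m (λ q r → f p q r))   ≈⟨ ∑ₐ-assoc f n ⟨
  ∑ₐ n (λ m r → ∑ₐ m (λ p q → f p q r))   ≈⟨ ∑ₐ-cong n (λ m r → ∑ₐ-comm (λ p q → f p q r) m) ⟩
  ∑ₐ n (λ m r → ∑ₐ m (λ p q → f q p r))   ≈⟨ ∑ₐ-assoc (λ p q r → f q p r) n ⟩
  ∑ₐ n (λ p m → ∑ₐ m (λ q r → f q p r))   ∎

-- Both sides run over the triples of total n - 1: on the left the term with m = 0 has an empty
-- inner sum, and without it every m drops by one.
∑ₐ⁻-assoc : ∀ (f : ℕ → ℕ → ℕ → ℚ[X]) n →
  ∑ₐ n (λ m r → ∑ₐ⁻ m (λ p q → f p q r)) ≈ ∑ₐ⁻ n (λ p m → ∑ₐ m (λ q r → f p q r))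
∑ₐ⁻-assoc f zero    = +ₚ-identityˡ _
∑ₐ⁻-assoc f (suc n) = begin
  ∑ₐ (suc n) (λ m r → ∑ₐ⁻ m (λ p q → f p q r))        ≈⟨ ∑ₐ-suc (λ m r → ∑ₐ⁻ m (λ p q → f p q r)) n ⟩
  0ₚ +ₚ ∑ₐ n (λ m r → ∑ₐ m (λ p q → f p q r))         ≈⟨ +ₚ-identityˡ _ ⟩
  ∑ₐ n (λ m r → ∑ₐ m (λ p q → f p q r))               ≈⟨ ∑ₐ-assoc f n ⟩
  ∑ₐ n (λ p m → ∑ₐ m (λ q r → f p q r))               ∎

∑ₐ⁻-exchange : ∀ (f : ℕ → ℕ → ℕ → ℚ[X]) n →
  ∑ₐ n (λ p m → ∑ₐ⁻ m (λ q r → f p q r)) ≈ ∑ₐ⁻ n (λ q m → ∑ₐ m (λ p r → f p q r))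
∑ₐ⁻-exchange f zero    = +ₚ-identityˡ _
∑ₐ⁻-exchange f (suc n) = begin
  ∑ₐ (suc n) (λ p m → ∑ₐ⁻ m (λ q r → f p q r))
    ≈⟨ ∑ₐ-suc′ (λ p m → ∑ₐ⁻ m (λ q r → f p q r)) n ⟩
  ∑ₐ n (λ p m → ∑ₐ m (λ q r → f p q r)) +ₚ 0ₚ
    ≈⟨ +-identityʳ _ ⟩
  ∑ₐ n (λ p m → ∑ₐ m (λ q r → f p q r))
    ≈⟨ ∑ₐ-exchange f n ⟩
  ∑ₐ n (λ q m → ∑ₐ m (λ p r → f p q r)) ∎

-- Sums over compositions

compositions : ℕ → ℕ → List (List ℕ)
compositions n       (suc k) =
  concatMap (λ (s , q) → map (s ∷_) (compositions q k)) (antidiagonal n)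
compositions zero    zero    = [] ∷ []
compositions (suc n) zero    = []

∑₊ : ℕ → ℕ → (List ℕ → ℚ[X]) → ℚ[X]
∑₊ n k f = ∑ (compositions n k) f

∑₊-suc : ∀ f n k → ∑₊ n (suc k) f ≈ ∑ₐ n (λ s q → ∑₊ q k (λ ss → f (s ∷ ss)))
∑₊-suc f n k = ≈-trans (∑-concatMap f _ (antidiagonal n))
  (∑ₐ-cong n (λ s q → ∑-map f (s ∷_) (compositions q k)))

∑₊-one : ∀ f n → ∑₊ n 1 f ≈ f (n ∷ [])
∑₊-one f n = ≈-trans (∑₊-suc f n 0) (last n (λ s ss → f (s ∷ ss)))
  where
  last : ∀ n (g : ℕ → List ℕ → ℚ[X]) → ∑ₐ n (λ s q → ∑₊ q 0 (g s)) ≈ g n []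
  last zero    g = ≈-trans (+-identityʳ _) (+-identityʳ _)
  last (suc n) g = ≈-trans (∑ₐ-suc (λ s q → ∑₊ q 0 (g s)) n)
    (≈-trans (+ₚ-identityˡ _) (last n (λ s → g (suc s))))

Symmetric : (List ℕ → ℚ[X]) → Set
Symmetric f = ∀ {ss ts} → ss ↭ ts → f ss ≈ f ts

Symmetric-∷ : ∀ {f} → Symmetric f → ∀ s → Symmetric (λ ss → f (s ∷ ss))
Symmetric-∷ f-sym s p = f-sym (↭.prep s p)

-- The total is a separate argument of `f`, so that it can be replaced by a constant while the
-- summands stay in place.
∑ₐ-total : ∀ (f : ℕ → ℕ → ℕ → ℚ[X]) n → ∑ₐ n (λ p q → f (p + q) p q) ≈ ∑ₐ n (f n)
∑ₐ-total f zero    = ≈-refl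
∑ₐ-total f (suc n) = begin
  ∑ₐ (suc n) (λ p q → f (p + q) p q)
    ≈⟨ ∑ₐ-suc (λ p q → f (p + q) p q) n ⟩
  f (suc n) 0 (suc n) +ₚ ∑ₐ n (λ p q → f (suc p + q) (suc p) q)
    ≈⟨ +-congˡ (∑ₐ-total (λ m p q → f (suc m) (suc p) q) n) ⟩
  f (suc n) 0 (suc n) +ₚ ∑ₐ n (λ p q → f (suc n) (suc p) q)
    ≈⟨ ∑ₐ-suc (f (suc n)) n ⟨
  ∑ₐ (suc n) (f (suc n)) ∎

∑₊-total : ∀ (f : ℕ → List ℕ → ℚ[X]) n k → ∑₊ n k (λ ss → f (sum ss) ss) ≈ ∑₊ n k (f n)
∑₊-total f zero    zero    = ≈-refl
∑₊-total f (suc n) zero    = ≈-refl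
∑₊-total f n       (suc k) = begin
  ∑₊ n (suc k) (λ ss → f (sum ss) ss)
    ≈⟨ ∑₊-suc _ n k ⟩
  ∑ₐ n (λ s q → ∑₊ q k (λ ss → f (s + sum ss) (s ∷ ss)))
    ≈⟨ ∑ₐ-cong n (λ s q → ∑₊-total (λ m ss → f (s + m) (s ∷ ss)) q k) ⟩
  ∑ₐ n (λ s q → ∑₊ q k (λ ss → f (s + q) (s ∷ ss)))
    ≈⟨ ∑ₐ-total (λ m s q → ∑₊ q k (λ ss → f m (s ∷ ss))) n ⟩
  ∑ₐ n (λ s q → ∑₊ q k (λ ss → f n (s ∷ ss)))
    ≈⟨ ∑₊-suc _ n k ⟨
  ∑₊ n (suc k) (f n) ∎

-- The parts add up to n, and by symmetry each of the k + 1 parts makes the same contribution as the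
-- first.
first-part-mean : ∀ {f} → Symmetric f → ∀ n k →
  natₚ (suc k) *ₚ ∑ₐ n (λ s q → natₚ s *ₚ ∑₊ q k (λ ss → f (s ∷ ss)))
    ≈ natₚ n *ₚ ∑₊ n (suc k) f
first-part-mean f-sym n k = ≈-trans (≈-sym (size-first f-sym n k)) (≈-trans
  (∑₊-total (λ m ss → natₚ m *ₚ _) n (suc k)) (∑-*ˡ (natₚ n) _ (compositions n (suc k))))
  where
  first : (List ℕ → ℚ[X]) → ℕ → ℕ → ℚ[X]
  first f n k = ∑ₐ n (λ s q → natₚ s *ₚ ∑₊ q k (λ ss → f (s ∷ ss)))

  size : (List ℕ → ℚ[X]) → List ℕ → ℚ[X]
  size f ss = natₚ (sum ss) *ₚ f ss

  size-first : ∀ {f} → Symmetric f → ∀ n k → ∑₊ n (suc k) (size f) ≈ natₚ (suc k) *ₚ first f n k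

  -- The mutual induction concentrates the weight of the k parts after s on the second part t;
  -- exchanging s and t, which `f` does not notice, makes t the first part.
  size-rest : ∀ {f} → Symmetric f → ∀ n k →
              ∑ₐ n (λ s q → ∑₊ q k (size (λ ss → f (s ∷ ss)))) ≈ natₚ k *ₚ first f n k
  size-rest {f} f-sym n zero = begin
    ∑ₐ n (λ s q → ∑₊ q 0 (size (λ ss → f (s ∷ ss))))
      ≈⟨ ∑ₐ-cong n (λ s q → ≈-trans (no-parts (λ ss → f (s ∷ ss)) q) (≈-sym (zeroʳ _))) ⟩
    ∑ₐ n (λ s q → 0ₚ *ₚ 0ₚ)
      ≈⟨ ∑-*ˡ 0ₚ _ (antidiagonal n) ⟩
    0ₚ *ₚ ∑ₐ n (λ s q → 0ₚ)
      ≈⟨ *ₚ-zeroˡ _ ⟩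
    0ₚ
      ≈⟨ *ₚ-zeroˡ _ ⟨
    natₚ 0 *ₚ first f n 0 ∎
    where
    no-parts : ∀ g q → ∑₊ q 0 (size g) ≈ 0ₚ
    no-parts g zero    = ≈-trans (+-identityʳ _) (*ₚ-zeroˡ _)
    no-parts g (suc q) = ≈-refl
  size-rest {f} f-sym n (suc k) = begin
    ∑ₐ n (λ s q → ∑₊ q (suc k) (size (λ ss → f (s ∷ ss))))
      ≈⟨ ∑ₐ-cong n (λ s q → size-first (Symmetric-∷ f-sym s) q k) ⟩
    ∑ₐ n (λ s q → natₚ (suc k) *ₚ ∑ₐ q (λ t r → natₚ t *ₚ ∑₊ r k (λ ss → f (s ∷ t ∷ ss))))
      ≈⟨ ∑-*ˡ (natₚ (suc k)) _ (antidiagonal n) ⟩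
    natₚ (suc k) *ₚ ∑ₐ n (λ s q → ∑ₐ q (λ t r → natₚ t *ₚ ∑₊ r k (λ ss → f (s ∷ t ∷ ss))))
      ≈⟨ *-congˡ (∑ₐ-exchange (λ s t r → natₚ t *ₚ ∑₊ r k (λ ss → f (s ∷ t ∷ ss))) n) ⟩
    natₚ (suc k) *ₚ ∑ₐ n (λ t q → ∑ₐ q (λ s r → natₚ t *ₚ ∑₊ r k (λ ss → f (s ∷ t ∷ ss))))
      ≈⟨ *-congˡ (∑ₐ-cong n (λ t q → ∑ₐ-cong q (λ s r → *-congˡ
           (∑-cong (compositions r k) (λ _ → f-sym (↭.swap s t ↭.refl)))))) ⟩
    natₚ (suc k) *ₚ ∑ₐ n (λ t q → ∑ₐ q (λ s r → natₚ t *ₚ ∑₊ r k (λ ss → f (t ∷ s ∷ ss))))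
      ≈⟨ *-congˡ (∑ₐ-cong n (λ t q → ≈-trans (∑-*ˡ (natₚ t) _ (antidiagonal q))
           (*-congˡ (≈-sym (∑₊-suc (λ ss → f (t ∷ ss)) q k))))) ⟩
    natₚ (suc k) *ₚ first f n (suc k) ∎

  size-first {f} f-sym n k = begin
    ∑₊ n (suc k) (size f)
      ≈⟨ ∑₊-suc (size f) n k ⟩
    ∑ₐ n (λ s q → ∑₊ q k (λ ss → natₚ (s + sum ss) *ₚ f (s ∷ ss)))
      ≈⟨ ∑ₐ-cong n (λ s q → ≈-trans
           (∑-cong (compositions q k) (λ _ → ≈-trans (*-congʳ (natₚ-+ s _)) (distribʳ _ _ _)))
           (≈-trans (∑-+ _ _ (compositions q k)) (+-congʳ (∑-*ˡ (natₚ s) _ (compositions q k))))) ⟩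
    ∑ₐ n (λ s q → natₚ s *ₚ ∑₊ q k (λ ss → f (s ∷ ss)) +ₚ ∑₊ q k (size (λ ss → f (s ∷ ss))))
      ≈⟨ ∑-+ _ _ (antidiagonal n) ⟩
    first f n k +ₚ ∑ₐ n (λ s q → ∑₊ q k (size (λ ss → f (s ∷ ss))))
      ≈⟨ +-congˡ (size-rest f-sym n k) ⟩
    first f n k +ₚ natₚ k *ₚ first f n k
      ≈⟨ natₚ-suc* k _ ⟨
    natₚ (suc k) *ₚ first f n k ∎

-- The weighted ways to split a block with s + 1 elements into an outer part with
-- c + 1 and an inner part with a + 1 elements: the inner part follows one of the
-- elements of the outer part, and the last one gives the interval partition.
splits : ℚ[X] → (List ℕ → ℚ[X]) → List ℕ → ℚ[X]
splits x f []       = 0ₚ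
splits x f (s ∷ ss) = ∑ₐ⁻ s (λ c a → (1ₚ +ₚ natₚ c *ₚ x) *ₚ f (c ∷ a ∷ ss))
  +ₚ splits x (λ ts → f (s ∷ ts)) ss

splits-cong : ∀ {x f g} → (∀ ss → f ss ≈ g ss) → ∀ ss → splits x f ss ≈ splits x g ss
splits-cong f≈g []       = ≈-refl
splits-cong f≈g (s ∷ ss) = +ₚ-cong
  (∑ₐ⁻-cong s (λ c a → *-congˡ (f≈g _))) (splits-cong (λ ts → f≈g (s ∷ ts)) ss)

-- Lets the induction on chains use `splits x f` as its new test function. When s and t are swapped,
-- their two contributions change places, and in each of them symmetry of `f` carries the two new
-- parts past the untouched one.
splits-symmetric : ∀ {x f} → Symmetric f → Symmetric (splits x f)
splits-symmetric f-sym ↭.refl        = ≈-refl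
splits-symmetric f-sym (↭.prep s p)  = +ₚ-cong
  (∑ₐ⁻-cong s (λ c a → *-congˡ (f-sym (↭.prep c (↭.prep a p)))))
  (splits-symmetric (Symmetric-∷ f-sym s) p)
splits-symmetric f-sym (↭.swap {xs = ss} s t p) = ≈-trans (+ₚ-x∙yz≈y∙xz _ _ _) (+ₚ-cong
  (∑ₐ⁻-cong t (λ c a → *-congˡ (f-sym
    (↭.trans (↭.trans (↭.swap s c ↭.refl) (↭.prep c (↭.swap s a ↭.refl))) (↭.prep c (↭.prep a (↭.prep s p)))))))
  (+ₚ-cong
    (∑ₐ⁻-cong s (λ c a → *-congˡ (f-sym
      (↭.trans (↭.prep c (↭.prep a (↭.prep t p))) (↭.trans (↭.prep c (↭.swap a t ↭.refl)) (↭.swap c t ↭.refl))))))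
    (≈-trans (splits-symmetric (Symmetric-∷ (Symmetric-∷ f-sym s) t) p)
      (splits-cong (λ ss → f-sym (↭.swap s t ↭.refl)) _))))
splits-symmetric f-sym (↭.trans p q) = ≈-trans (splits-symmetric f-sym p) (splits-symmetric f-sym q)

-- Once a part is cut into c and a, only c enters the weight, so a can be counted among the other
-- parts. By symmetry all k choices of the part to be cut give the same sum.
∑₊-splits : ∀ {x f} → Symmetric f → ∀ n k → ∑₊ n k (splits x f) ≈
  natₚ k *ₚ ∑ₐ⁻ n (λ s q → (1ₚ +ₚ natₚ s *ₚ x) *ₚ ∑₊ q k (λ ss → f (s ∷ ss)))
∑₊-splits f-sym zero    zero    = ≈-trans (+ₚ-identityˡ _) (≈-sym (*ₚ-zeroˡ _))
∑₊-splits f-sym (suc n) zero    = ≈-sym (*ₚ-zeroˡ _)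
∑₊-splits {x} {f} f-sym n (suc k) = begin
  ∑₊ n (suc k) (splits x f)
    ≈⟨ ∑₊-suc (splits x f) n k ⟩
  ∑ₐ n (λ b q → ∑₊ q k (λ ss → ∑ₐ⁻ b (λ c a → w c *ₚ f (c ∷ a ∷ ss)) +ₚ splits x (λ ts → f (b ∷ ts)) ss))
    ≈⟨ ∑ₐ-cong n (λ b q → ∑-+ _ _ (compositions q k)) ⟩
  ∑ₐ n (λ b q → ∑₊ q k (λ ss → ∑ₐ⁻ b (λ c a → w c *ₚ f (c ∷ a ∷ ss))) +ₚ ∑₊ q k (splits x (λ ts → f (b ∷ ts))))
    ≈⟨ ∑-+ _ _ (antidiagonal n) ⟩
  ∑ₐ n (λ b q → ∑₊ q k (λ ss → ∑ₐ⁻ b (λ c a → w c *ₚ f (c ∷ a ∷ ss)))) +ₚ ∑ₐ n (λ b q → ∑₊ q k (splits x (λ ts → f (b ∷ ts))))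
    ≈⟨ +ₚ-cong head-split tail-split ⟩
  T +ₚ natₚ k *ₚ T
    ≈⟨ natₚ-suc* k T ⟨
  natₚ (suc k) *ₚ T ∎
  where
  w : ℕ → ℚ[X]
  w c = 1ₚ +ₚ natₚ c *ₚ x

  T : ℚ[X]
  T = ∑ₐ⁻ n (λ s q → w s *ₚ ∑₊ q (suc k) (λ ss → f (s ∷ ss)))

  collect : ∀ s m → ∑ₐ m (λ t r → w s *ₚ ∑₊ r k (λ ss → f (s ∷ t ∷ ss)))
                      ≈ w s *ₚ ∑₊ m (suc k) (λ ss → f (s ∷ ss))
  collect s m = ≈-trans (∑-*ˡ (w s) _ (antidiagonal m))
    (*-congˡ (≈-sym (∑₊-suc (λ ss → f (s ∷ ss)) m k)))

  head-split : ∑ₐ n (λ b q → ∑₊ q k (λ ss → ∑ₐ⁻ b (λ c a → w c *ₚ f (c ∷ a ∷ ss)))) ≈ T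
  head-split = begin
    ∑ₐ n (λ b q → ∑₊ q k (λ ss → ∑ₐ⁻ b (λ c a → w c *ₚ f (c ∷ a ∷ ss))))
      ≈⟨ ∑ₐ-cong n (λ b q → ≈-trans (∑-swap _ (compositions q k) (antidiagonal⁻ b))
           (∑ₐ⁻-cong b (λ c a → ∑-*ˡ (w c) _ (compositions q k)))) ⟩
    ∑ₐ n (λ b q → ∑ₐ⁻ b (λ c a → w c *ₚ ∑₊ q k (λ ss → f (c ∷ a ∷ ss))))
      ≈⟨ ∑ₐ⁻-assoc (λ c a q → w c *ₚ ∑₊ q k (λ ss → f (c ∷ a ∷ ss))) n ⟩
    ∑ₐ⁻ n (λ c m → ∑ₐ m (λ a q → w c *ₚ ∑₊ q k (λ ss → f (c ∷ a ∷ ss))))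
      ≈⟨ ∑ₐ⁻-cong n collect ⟩
    T ∎

  tail-split : ∑ₐ n (λ b q → ∑₊ q k (splits x (λ ts → f (b ∷ ts)))) ≈ natₚ k *ₚ T
  tail-split = begin
    ∑ₐ n (λ b q → ∑₊ q k (splits x (λ ts → f (b ∷ ts))))
      ≈⟨ ∑ₐ-cong n (λ b q → ∑₊-splits (Symmetric-∷ f-sym b) q k) ⟩
    ∑ₐ n (λ b q → natₚ k *ₚ ∑ₐ⁻ q (λ s r → w s *ₚ ∑₊ r k (λ ss → f (b ∷ s ∷ ss))))
      ≈⟨ ∑-*ˡ (natₚ k) _ (antidiagonal n) ⟩
    natₚ k *ₚ ∑ₐ n (λ b q → ∑ₐ⁻ q (λ s r → w s *ₚ ∑₊ r k (λ ss → f (b ∷ s ∷ ss))))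
      ≈⟨ *-congˡ (∑ₐ⁻-exchange (λ b s r → w s *ₚ ∑₊ r k (λ ss → f (b ∷ s ∷ ss))) n) ⟩
    natₚ k *ₚ ∑ₐ⁻ n (λ s m → ∑ₐ m (λ b r → w s *ₚ ∑₊ r k (λ ss → f (b ∷ s ∷ ss))))
      ≈⟨ *-congˡ (∑ₐ⁻-cong n (λ s m → ≈-trans
           (∑ₐ-cong m (λ b r → *-congˡ (∑-cong (compositions r k) (λ _ → f-sym (↭.swap b s ↭.refl)))))
           (collect s m))) ⟩
    natₚ k *ₚ T ∎

-- The outer part is the first of k + 2 parts of total n, so its s may be replaced by n / (k + 2),
-- and k + 2 times 1 + s x becomes n x + (k + 2). A cut adds one part and takes one from the sum of
-- the lowered sizes, hence `suc n` on the left and `n` on the right.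
∑₊-splits-mean : ∀ {x f} → Symmetric f → ∀ n k →
  natₚ (suc (suc k)) *ₚ ∑₊ (suc n) (suc k) (splits x f) ≈
  natₚ (suc k) *ₚ ((natₚ n *ₚ x +ₚ natₚ (suc (suc k))) *ₚ ∑₊ n (suc (suc k)) f)
∑₊-splits-mean {x} {f} f-sym n k = begin
  K *ₚ ∑₊ (suc n) (suc k) (splits x f)
    ≈⟨ *-congˡ (∑₊-splits f-sym (suc n) (suc k)) ⟩
  K *ₚ (natₚ (suc k) *ₚ ∑ₐ n (λ s q → (1ₚ +ₚ natₚ s *ₚ x) *ₚ F s q))
    ≈⟨ *ₚ-x∙yz≈y∙xz _ _ _ ⟩
  natₚ (suc k) *ₚ (K *ₚ ∑ₐ n (λ s q → (1ₚ +ₚ natₚ s *ₚ x) *ₚ F s q))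
    ≈⟨ *-congˡ (*-congˡ weights) ⟩
  natₚ (suc k) *ₚ (K *ₚ (E +ₚ x *ₚ V))
    ≈⟨ *-congˡ (*ₚ-distribˡ _ _ _) ⟩
  natₚ (suc k) *ₚ (K *ₚ E +ₚ K *ₚ (x *ₚ V))
    ≈⟨ *-congˡ (+-congˡ (≈-trans (*ₚ-x∙yz≈y∙xz _ _ _) (*-congˡ (first-part-mean f-sym n (suc k))))) ⟩
  natₚ (suc k) *ₚ (K *ₚ E +ₚ x *ₚ (natₚ n *ₚ E))
    ≈⟨ *-congˡ (+-congˡ (≈-trans (*ₚ-x∙yz≈y∙xz _ _ _) (≈-sym (*ₚ-assoc _ _ _)))) ⟩
  natₚ (suc k) *ₚ (K *ₚ E +ₚ natₚ n *ₚ x *ₚ E)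
    ≈⟨ *-congˡ (≈-trans (+ₚ-comm _ _) (≈-sym (distribʳ _ _ _))) ⟩
  natₚ (suc k) *ₚ ((natₚ n *ₚ x +ₚ K) *ₚ E) ∎
  where
  K E V : ℚ[X]
  K = natₚ (suc (suc k))
  E = ∑₊ n (suc (suc k)) f

  F : ℕ → ℕ → ℚ[X]
  F s q = ∑₊ q (suc k) (λ ss → f (s ∷ ss))

  V = ∑ₐ n (λ s q → natₚ s *ₚ F s q)

  weights : ∑ₐ n (λ s q → (1ₚ +ₚ natₚ s *ₚ x) *ₚ F s q) ≈ E +ₚ x *ₚ V
  weights = begin
    ∑ₐ n (λ s q → (1ₚ +ₚ natₚ s *ₚ x) *ₚ F s q)
      ≈⟨ ∑ₐ-cong n (λ s q → ≈-trans (distribʳ _ _ _) (+ₚ-cong (*ₚ-identityˡ _)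
           (≈-trans (*-congʳ (*ₚ-comm _ _)) (*ₚ-assoc _ _ _)))) ⟩
    ∑ₐ n (λ s q → F s q +ₚ x *ₚ (natₚ s *ₚ F s q))
      ≈⟨ ∑-+ _ _ (antidiagonal n) ⟩
    ∑ₐ n F +ₚ ∑ₐ n (λ s q → x *ₚ (natₚ s *ₚ F s q))
      ≈⟨ +ₚ-cong (≈-sym (∑₊-suc f n (suc k))) (∑-*ˡ x _ (antidiagonal n)) ⟩
    E +ₚ x *ₚ V ∎

∑₊-1 : ∀ n k → ∑₊ n (suc k) (λ _ → 1ₚ) ≈ natₚ ((n + k) C k)
∑₊-1 n zero = ∑₊-one _ n
∑₊-1 zero (suc k) = begin
  ∑₊ 0 (suc (suc k)) (λ _ → 1ₚ)               ≈⟨ ∑₊-suc _ 0 (suc k) ⟩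
  ∑₊ 0 (suc k) (λ _ → 1ₚ) +ₚ 0ₚ               ≈⟨ +-identityʳ _ ⟩
  ∑₊ 0 (suc k) (λ _ → 1ₚ)                     ≈⟨ ∑₊-1 0 k ⟩
  natₚ (k C k)                               ≡⟨ cong natₚ (trans (nCn≡1 k) (sym (nCn≡1 (suc k)))) ⟩
  natₚ (suc k C suc k)                       ∎
∑₊-1 (suc n) (suc k) = begin
  ∑₊ (suc n) (suc (suc k)) (λ _ → 1ₚ)
    ≈⟨ ∑₊-suc _ (suc n) (suc k) ⟩
  ∑ₐ (suc n) (λ s q → ∑₊ q (suc k) (λ _ → 1ₚ))
    ≈⟨ ∑ₐ-suc (λ s q → ∑₊ q (suc k) (λ _ → 1ₚ)) n ⟩
  ∑₊ (suc n) (suc k) (λ _ → 1ₚ) +ₚ ∑ₐ n (λ s q → ∑₊ q (suc k) (λ _ → 1ₚ))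
    ≈⟨ +-congˡ (∑₊-suc _ n (suc k)) ⟨
  ∑₊ (suc n) (suc k) (λ _ → 1ₚ) +ₚ ∑₊ n (suc (suc k)) (λ _ → 1ₚ)
    ≈⟨ +ₚ-cong (∑₊-1 (suc n) k) (∑₊-1 n (suc k)) ⟩
  natₚ ((suc n + k) C k) +ₚ natₚ ((n + suc k) C suc k)
    ≡⟨ cong (λ m → natₚ (m C k) +ₚ natₚ ((n + suc k) C suc k)) (sym (ℕ.+-suc n k)) ⟩
  natₚ ((n + suc k) C k) +ₚ natₚ ((n + suc k) C suc k)
    ≈⟨ natₚ-+ ((n + suc k) C k) ((n + suc k) C suc k) ⟨
  natₚ ((n + suc k) C k + (n + suc k) C suc k)
    ≡⟨ cong natₚ (nCk+nC[k+1]≡[n+1]C[k+1] (n + suc k) k) ⟩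
  natₚ ((suc n + suc k) C suc k) ∎

-- Noncrossing partitions as equivalence relations

private
  variable
    n : ℕ
    x y z i j : Fin n

infix 4 _∼⟨_⟩_ _∼⟨_⟩?_

-- A record instead of an abbreviation, so that `x`, `π` and `y` can be recovered from the type.
record _∼⟨_⟩_ {n} (x : Fin n) (π : NC n) (y : Fin n) : Set where
  constructor member
  field ∈block : y ∈ₛ lookup (blocks π) x

open _∼⟨_⟩_

_∼⟨_⟩?_ : (x : Fin n) (π : NC n) (y : Fin n) → Dec (x ∼⟨ π ⟩ y)
x ∼⟨ π ⟩? y = map′ member ∈block (y ∈? lookup (blocks π) x)

valid : (π : NC n) → IsPartition (blocks π) × Noncrossing (blocks π)
valid (nc π p) = recompute (isNC? π) p

∼-refl : (π : NC n) → x ∼⟨ π ⟩ x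
∼-refl π = member (proj₁ (proj₁ (valid π)) _)

∼-block : (π : NC n) → x ∼⟨ π ⟩ y → lookup (blocks π) y ≡ lookup (blocks π) x
∼-block π (member y∈x) = proj₂ (proj₁ (valid π)) _ _ y∈x

∼-sym : (π : NC n) → x ∼⟨ π ⟩ y → y ∼⟨ π ⟩ x
∼-sym π x∼y = member (subst (_ ∈ₛ_) (sym (∼-block π x∼y)) (∈block (∼-refl π)))

∼-trans : (π : NC n) → x ∼⟨ π ⟩ y → y ∼⟨ π ⟩ z → x ∼⟨ π ⟩ z
∼-trans π x∼y (member z∈y) = member (subst (_ ∈ₛ_) (∼-block π x∼y) z∈y)

∼-noncrossing : (π : NC n) {a b c d : Fin n} → a < b → b < c → c < d →
                a ∼⟨ π ⟩ c → b ∼⟨ π ⟩ d → a ∼⟨ π ⟩ b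
∼-noncrossing π {a} {b} {c} {d} a<b b<c c<d (member c∈a) (member d∈b) =
  decidable-stable (a ∼⟨ π ⟩? b) λ a≁b →
    proj₂ (valid π) a b c d a<b b<c c<d
      (c∈a , d∈b , λ a≡b → a≁b (member (subst (b ∈ₛ_) (sym a≡b) (∈block (∼-refl π)))))

NC-ext : {π ρ : NC n} → (∀ {x y} → x ∼⟨ π ⟩ y → x ∼⟨ ρ ⟩ y) →
         (∀ {x y} → x ∼⟨ ρ ⟩ y → x ∼⟨ π ⟩ y) → π ≡ ρ
NC-ext {π = nc bs _} {ρ = nc cs _} π⊆ρ ρ⊆π = go (trans (sym (tabulate∘lookup bs))
    (trans (tabulate-cong (λ x → ⊆-antisym (∈block ∘ π⊆ρ ∘ member) (∈block ∘ ρ⊆π ∘ member)))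
      (tabulate∘lookup cs)))
  where
  go : ∀ {bs cs} .{p} .{q} → bs ≡ cs → nc bs p ≡ nc cs q
  go refl = refl

≤ₙ⇒⊆ : {ρ π : NC n} → ρ ≤ₙ π → x ∼⟨ ρ ⟩ y → x ∼⟨ π ⟩ y
≤ₙ⇒⊆ {x = x} {ρ = ρ} {π} ρ≤π (member y∈x) =
  ∼-trans π (∼-sym π (member (at (∈block (∼-refl ρ))))) (member (at y∈x))
  where
  coarser = All.lookup⁺ ρ≤π x
  at : lookup (blocks ρ) x ⊆ lookup (blocks π) (Any.index coarser)
  at = Any.lookup-index coarser

any-at : ∀ {A : Set} {P : A → Set} {n} (v : Vec A n) i → P (lookup v i) → Any P v
any-at v i p = subst (Any _) (tabulate∘lookup v) (Any.tabulate⁺ i p)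

⊆⇒≤ₙ : {ρ π : NC n} → (∀ {x y} → x ∼⟨ ρ ⟩ y → x ∼⟨ π ⟩ y) → ρ ≤ₙ π
⊆⇒≤ₙ {π = π} ρ⊆π = All.lookup⁻ (λ x → any-at (blocks π) x (∈block ∘ ρ⊆π ∘ member))

module _ {R : Fin n → Fin n → Set} (R? : ∀ x y → Dec (R x y))
  (R-refl : ∀ {x} → R x x) (R-sym : ∀ {x y} → R x y → R y x)
  (R-trans : ∀ {x y z} → R x y → R y z → R x z)
  (R-noncrossing : ∀ {a b c d} → a < b → b < c → c < d → R a c → R b d → R a b)
  where

  private
    classes : Vec (Subset n) n
    classes = tabulate (λ x → tabulate (λ y → does (R? x y)))

    lookup-classes : ∀ x y → lookup (lookup classes x) y ≡ does (R? x y)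
    lookup-classes x y = trans (cong (λ B → lookup B y) (lookup∘tabulate _ x)) (lookup∘tabulate _ y)

    R⇒∈ : ∀ x y → R x y → y ∈ₛ lookup classes x
    R⇒∈ x y r = lookup⇒[]= y _ (trans (lookup-classes x y) (dec-true (R? x y) r))

    ∈⇒R : ∀ x y → y ∈ₛ lookup classes x → R x y
    ∈⇒R x y y∈x with R? x y | trans (sym (lookup-classes x y)) ([]=⇒lookup y∈x)
    ... | yes r | _ = r

    same-class : ∀ x y → R x y → lookup classes y ≡ lookup classes x
    same-class x y r = ⊆-antisym
      (λ {z} z∈y → R⇒∈ x z (R-trans r (∈⇒R y z z∈y)))
      (λ {z} z∈x → R⇒∈ y z (R-trans (R-sym r) (∈⇒R x z z∈x)))

  abstract
    quotient : NC n
    quotient = nc classes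
      ( ((λ x → R⇒∈ x x R-refl) , (λ x y y∈x → same-class x y (∈⇒R x y y∈x)))
      , (λ a b c d a<b b<c c<d (c∈a , d∈b , a≢b) → a≢b (sym (same-class a b
          (R-noncrossing a<b b<c c<d (∈⇒R a c c∈a) (∈⇒R b d d∈b))))) )

    quotient⁺ : R x y → x ∼⟨ quotient ⟩ y
    quotient⁺ r = member (R⇒∈ _ _ r)

    quotient⁻ : x ∼⟨ quotient ⟩ y → R x y
    quotient⁻ (member y∈x) = ∈⇒R _ _ y∈x

-- Cutting one block in two

Between : (i j x : Fin n) → Set
Between i j x = i ≤ x × x < j

between? : (i j x : Fin n) → Dec (Between i j x)
between? i j x = i ≤? x ×-dec x <? j

SameSide : (i j x y : Fin n) → Set
SameSide i j x y = (Between i j x → Between i j y) × (Between i j y → Between i j x)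

-- The block containing i is split into its elements in [i , j) and the others.
-- If i and j are distinct elements of one block B, these are the cuts of the
-- cyclically ordered set B, hence all the noncrossing ways to split B.
module _ (π : NC n) (i j : Fin n) where

  private
    R : Fin n → Fin n → Set
    R x y = x ∼⟨ π ⟩ y × (i ∼⟨ π ⟩ x → SameSide i j x y)

    R? : ∀ x y → Dec (R x y)
    R? x y = x ∼⟨ π ⟩? y ×-dec (i ∼⟨ π ⟩? x →-dec
      ((between? i j x →-dec between? i j y) ×-dec (between? i j y →-dec between? i j x)))

    R-refl : ∀ {x} → R x x
    R-refl = ∼-refl π , λ _ → (λ b → b) , (λ b → b)

    R-sym : ∀ {x y} → R x y → R y x
    R-sym (x∼y , same) = ∼-sym π x∼y , λ i∼y →
      let to , from = same (∼-trans π i∼y (∼-sym π x∼y)) in from , to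

    R-trans : ∀ {x y z} → R x y → R y z → R x z
    R-trans (x∼y , same-xy) (y∼z , same-yz) = ∼-trans π x∼y y∼z , λ i∼x →
      let to , from = same-xy i∼x ; to′ , from′ = same-yz (∼-trans π i∼x x∼y)
      in to′ ∘ to , from ∘ from′

    -- Since `π` is noncrossing, a, b, c and d share a block. If a lies in [i, j), so does c, and b
    -- between them; if b does, so does d, hence c between them, and then a.
    R-noncrossing : ∀ {a b c d} → a < b → b < c → c < d → R a c → R b d → R a b
    R-noncrossing {a} {b} {c} {d} a<b b<c c<d (a∼c , same-ac) (b∼d , same-bd) =
      a∼b , λ i∼a →
        ( (λ (i≤a , a<j) → ℕ.≤-trans i≤a (ℕ.<⇒≤ a<b)
                         , ℕ.<-trans b<c (proj₂ (proj₁ (same-ac i∼a) (i≤a , a<j))))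
        , (λ (i≤b , b<j) → proj₂ (same-ac i∼a)
              ( ℕ.≤-trans i≤b (ℕ.<⇒≤ b<c)
              , ℕ.<-trans c<d (proj₂ (proj₁ (same-bd (∼-trans π i∼a a∼b)) (i≤b , b<j))))) )
      where a∼b = ∼-noncrossing π a<b b<c c<d a∼c b∼d

  abstract
    split : NC n
    split = quotient R? R-refl R-sym R-trans R-noncrossing

    split⁺ : x ∼⟨ π ⟩ y → (i ∼⟨ π ⟩ x → SameSide i j x y) → x ∼⟨ split ⟩ y
    split⁺ x∼y same = quotient⁺ R? R-refl R-sym R-trans R-noncrossing (x∼y , same)

    split⁻ : x ∼⟨ split ⟩ y → x ∼⟨ π ⟩ y × (i ∼⟨ π ⟩ x → SameSide i j x y)
    split⁻ = quotient⁻ R? R-refl R-sym R-trans R-noncrossing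

  split-inside : x ∼⟨ π ⟩ y → Between i j x → Between i j y → x ∼⟨ split ⟩ y
  split-inside x∼y bx by = split⁺ x∼y λ _ → (λ _ → by) , (λ _ → bx)

  split-outside : x ∼⟨ π ⟩ y → ¬ Between i j x → ¬ Between i j y → x ∼⟨ split ⟩ y
  split-outside x∼y ¬bx ¬by = split⁺ x∼y λ _ →
    (λ bx → contradiction bx ¬bx) , (λ by → contradiction by ¬by)

  split⊆ : x ∼⟨ split ⟩ y → x ∼⟨ π ⟩ y
  split⊆ = proj₁ ∘ split⁻

  split-separates : i ∼⟨ π ⟩ x → Between i j x → ¬ Between i j y → ¬ x ∼⟨ split ⟩ y
  split-separates i∼x bx ¬by x∼y = ¬by (proj₁ (proj₂ (split⁻ x∼y) i∼x) bx)

  split-elsewhere : ¬ i ∼⟨ π ⟩ x → x ∼⟨ π ⟩ y → x ∼⟨ split ⟩ y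
  split-elsewhere i≁x x∼y = split⁺ x∼y λ i∼x → contradiction i∼x i≁x

between-start : i < j → Between i j i
between-start i<j = ℕ.≤-refl , i<j

¬between-end : ¬ Between i j j
¬between-end (_ , j<j) = ℕ.<-irrefl refl j<j

¬between-before : x < i → ¬ Between i j x
¬between-before x<i (i≤x , _) = ℕ.<⇒≱ x<i i≤x

split-cases : (π : NC n) (i j : Fin n) → x ∼⟨ π ⟩ y →
  x ∼⟨ split π i j ⟩ y ⊎ i ∼⟨ π ⟩ x ×
    (Between i j x × ¬ Between i j y ⊎ ¬ Between i j x × Between i j y)
split-cases {x = x} {y} π i j x∼y with i ∼⟨ π ⟩? x | between? i j x | between? i j y
... | no i≁x  | _      | _      = inj₁ (split-elsewhere π i j i≁x x∼y)
... | yes i∼x | yes bx | yes by = inj₁ (split-inside π i j x∼y bx by)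
... | yes i∼x | no ¬bx | no ¬by = inj₁ (split-outside π i j x∼y ¬bx ¬by)
... | yes i∼x | yes bx | no ¬by = inj₂ (i∼x , inj₁ (bx , ¬by))
... | yes i∼x | no ¬bx | yes by = inj₂ (i∼x , inj₂ (¬bx , by))

module _ (π : NC n) (i<j : i < j) (i∼j : i ∼⟨ π ⟩ j) where

  private
    ρ : NC n
    ρ = split π i j

  -- The cut has only two parts, represented by i and j. A partition σ between the cut and `π`
  -- either joins i and j, and then the whole parts, so that σ is `π`, or keeps the parts separate
  -- and equals the cut.
  split-⋖ : split π i j ⋖ π
  split-⋖ = (⊆⇒≤ₙ (split⊆ π i j) , λ ρ≡π →
      split-separates π i j (∼-refl π) (between-start i<j) ¬between-end
        (subst (λ σ → i ∼⟨ σ ⟩ j) (sym ρ≡π) i∼j))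
    , λ (σ , (ρ≤σ , ρ≢σ) , (σ≤π , σ≢π)) → no-between σ (≤ₙ⇒⊆ ρ≤σ) ρ≢σ (≤ₙ⇒⊆ σ≤π) σ≢π
    where
    no-between : ∀ σ → (∀ {x y} → x ∼⟨ ρ ⟩ y → x ∼⟨ σ ⟩ y) → ρ ≢ σ →
                 (∀ {x y} → x ∼⟨ σ ⟩ y → x ∼⟨ π ⟩ y) → σ ≢ π → _
    no-between σ ρ⊆σ ρ≢σ σ⊆π σ≢π with i ∼⟨ σ ⟩? j
    ... | yes i∼σj = σ≢π (NC-ext σ⊆π π⊆σ)
      where
      across : ∀ {x y} → i ∼⟨ π ⟩ x → x ∼⟨ π ⟩ y → Between i j x → ¬ Between i j y → x ∼⟨ σ ⟩ y
      across i∼x x∼y bx ¬by =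
        ∼-trans σ (ρ⊆σ (split-inside π i j (∼-sym π i∼x) bx (between-start i<j)))
          (∼-trans σ i∼σj (ρ⊆σ (split-outside π i j
            (∼-trans π (∼-sym π i∼j) (∼-trans π i∼x x∼y)) ¬between-end ¬by)))

      π⊆σ : ∀ {x y} → x ∼⟨ π ⟩ y → x ∼⟨ σ ⟩ y
      π⊆σ x∼y with split-cases π i j x∼y
      ... | inj₁ x∼ρy                      = ρ⊆σ x∼ρy
      ... | inj₂ (i∼x , inj₁ (bx , ¬by)) = across i∼x x∼y bx ¬by
      ... | inj₂ (i∼x , inj₂ (¬bx , by)) =
        ∼-sym σ (across (∼-trans π i∼x x∼y) (∼-sym π x∼y) by ¬bx)
    ... | no i≁σj = ρ≢σ (NC-ext ρ⊆σ σ⊆ρ)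
      where
      across : ∀ {x y} → i ∼⟨ π ⟩ x → x ∼⟨ σ ⟩ y → Between i j x → ¬ ¬ Between i j y
      across i∼x x∼y bx ¬by = i≁σj $
        ∼-trans σ (ρ⊆σ (split-inside π i j i∼x (between-start i<j) bx))
          (∼-trans σ x∼y (ρ⊆σ (split-outside π i j
            (∼-trans π (∼-sym π (∼-trans π i∼x (σ⊆π x∼y))) i∼j) ¬by ¬between-end)))

      σ⊆ρ : ∀ {x y} → x ∼⟨ σ ⟩ y → x ∼⟨ ρ ⟩ y
      σ⊆ρ x∼y with split-cases π i j (σ⊆π x∼y)
      ... | inj₁ x∼ρy                      = x∼ρy
      ... | inj₂ (i∼x , inj₁ (bx , ¬by)) = contradiction ¬by (across i∼x x∼y bx)
      ... | inj₂ (i∼x , inj₂ (¬bx , by)) =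
        contradiction ¬bx (across (∼-trans π i∼x (σ⊆π x∼y)) (∼-sym σ x∼y) by)

-- Lower covers are cuts

least : {P : Fin n → Set} → Decidable P → ∃ P → ∃ λ m → P m × (∀ {x} → P x → m ≤ x)
least {suc n} {P} P? (x , px) with P? zero
... | yes p₀ = zero , p₀ , λ _ → z≤n
... | no ¬p₀ with x | px
...   | zero   | p₀ = contradiction p₀ ¬p₀
...   | suc x′ | px′ with least (λ y → P? (suc y)) (x′ , px′)
...     | m , pm , m-least = suc m , pm , below
  where
  below : ∀ {y} → P y → suc m ≤ y
  below {zero}  p₀ = contradiction p₀ ¬p₀
  below {suc y} py = s≤s (m-least py)

≤∧≢⇒< : x ≤ y → x ≢ y → x < y
≤∧≢⇒< x≤y x≢y = ℕ.≤∧≢⇒< x≤y (x≢y ∘ toℕ-injective)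

-- If ρ is a lower cover, nothing lies strictly between it and `π`, so a cut that ρ refines must be
-- ρ itself. Thus a single suitable cut is enough to identify all covers.
below-split : {ρ π : NC n} → ρ <ₙ π →
  ∃₂ λ i j → i < j × i ∼⟨ π ⟩ j × (∀ {x y} → x ∼⟨ ρ ⟩ y → x ∼⟨ split π i j ⟩ y)
below-split {n} {ρ} {π} (ρ≤π , ρ≢π) = cut-block split-pair
  where
  ρ⊆π : ∀ {x y} → x ∼⟨ ρ ⟩ y → x ∼⟨ π ⟩ y
  ρ⊆π = ≤ₙ⇒⊆ ρ≤π

  not-coarser : ¬ (∀ x y → x ∼⟨ π ⟩ y → x ∼⟨ ρ ⟩ y)
  not-coarser π⊆ρ = ρ≢π (NC-ext ρ⊆π (π⊆ρ _ _))

  split-pair : ∃₂ λ x y → x ∼⟨ π ⟩ y × ¬ x ∼⟨ ρ ⟩ y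
  split-pair with ¬∀⟶∃¬ n _ (λ x → all? λ y → x ∼⟨ π ⟩? y →-dec x ∼⟨ ρ ⟩? y) not-coarser
  ... | x , ¬all with ¬∀⟶∃¬ n _ (λ y → x ∼⟨ π ⟩? y →-dec x ∼⟨ ρ ⟩? y) ¬all
  ...   | y , ¬imp with x ∼⟨ π ⟩? y | x ∼⟨ ρ ⟩? y
  ...     | _       | yes x∼ρy = contradiction (λ _ → x∼ρy) ¬imp
  ...     | no x≁y  | no _     = contradiction (λ x∼y → contradiction x∼y x≁y) ¬imp
  ...     | yes x∼y | no x≁ρy  = x , y , x∼y , x≁ρy

  Cut : Set
  Cut = ∃₂ λ i j → i < j × i ∼⟨ π ⟩ j × (∀ {x y} → x ∼⟨ ρ ⟩ y → x ∼⟨ split π i j ⟩ y)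

  -- m is the least element of a block that ρ splits, i the least element of
  -- this block outside the block C of m in ρ, and j the next element of C.
  module _ {m i} (m-least : ∀ {x} → m ∼⟨ π ⟩ x → m ≤ x) (m∼i : m ∼⟨ π ⟩ i) (m≁ρi : ¬ m ∼⟨ ρ ⟩ i)
    (i-least : ∀ {x} → m ∼⟨ π ⟩ x × ¬ m ∼⟨ ρ ⟩ x → i ≤ x) where

    m<i : m < i
    m<i = ≤∧≢⇒< (m-least m∼i) λ m≡i → m≁ρi (subst (m ∼⟨ ρ ⟩_) m≡i (∼-refl ρ))

    before-i : ∀ {u} → m ∼⟨ π ⟩ u → u < i → m ∼⟨ ρ ⟩ u
    before-i {u} m∼u u<i = decidable-stable (m ∼⟨ ρ ⟩? u)
      λ m≁ρu → ℕ.<⇒≱ u<i (i-least (m∼u , m≁ρu))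

    Next : Fin n → Set
    Next z = i < z × m ∼⟨ ρ ⟩ z

    next? : Decidable Next
    next? z = i <? z ×-dec m ∼⟨ ρ ⟩? z

    -- All elements of the block of `π` before i belong to C, and here C has none after i. So C
    -- consists of the elements of the block in [m, i).
    cut-without-next : ¬ ∃ Next → Cut
    cut-without-next ¬next = m , i , m<i , m∼i , λ u∼v → split⁺ π m i (ρ⊆π u∼v) λ m∼u →
      side m∼u u∼v , side (∼-trans π m∼u (ρ⊆π u∼v)) (∼-sym ρ u∼v)
      where
      side : ∀ {u v} → m ∼⟨ π ⟩ u → u ∼⟨ ρ ⟩ v → Between m i u → Between m i v
      side {u} {v} m∼u u∼v (_ , u<i) = m-least (ρ⊆π m∼ρv) , ℕ.≰⇒> λ i≤v →
        ¬next (v , ≤∧≢⇒< i≤v (λ i≡v → m≁ρi (subst (m ∼⟨ ρ ⟩_) (sym i≡v) m∼ρv)) , m∼ρv)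
        where m∼ρv = ∼-trans ρ (before-i m∼u u<i) u∼v

    -- No element of the block in [i, j) belongs to C. A block of `ρ` containing such an element u
    -- cannot reach below i, where the elements of the block of `π` are in C, nor beyond j to some
    -- v, because m < u < j < v would be a crossing with m and j in C.
    cut-at-next : ∀ {j} → i < j → m ∼⟨ ρ ⟩ j → (∀ {x} → Next x → j ≤ x) → Cut
    cut-at-next {j} i<j m∼ρj j-least =
      i , j , i<j , ∼-trans π (∼-sym π m∼i) (ρ⊆π m∼ρj) , λ u∼v → split⁺ π i j (ρ⊆π u∼v) λ i∼u →
        side (∼-trans π m∼i i∼u) u∼v , side (∼-trans π m∼i (∼-trans π i∼u (ρ⊆π u∼v))) (∼-sym ρ u∼v)
      where
      side : ∀ {u v} → m ∼⟨ π ⟩ u → u ∼⟨ ρ ⟩ v → Between i j u → Between i j v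
      side {u} {v} m∼u u∼v (i≤u , u<j) = ℕ.≮⇒≥ i≰v , ≤∧≢⇒< (ℕ.≮⇒≥ j≮v) v≢j
        where
        m≁ρu : ¬ m ∼⟨ ρ ⟩ u
        m≁ρu m∼ρu = ℕ.<⇒≱ u<j (j-least
          (≤∧≢⇒< i≤u (λ i≡u → m≁ρi (subst (m ∼⟨ ρ ⟩_) (sym i≡u) m∼ρu)) , m∼ρu))

        m≁ρv : ¬ m ∼⟨ ρ ⟩ v
        m≁ρv m∼ρv = m≁ρu (∼-trans ρ m∼ρv (∼-sym ρ u∼v))

        i≰v : ¬ v < i
        i≰v v<i = m≁ρv (before-i (∼-trans π m∼u (ρ⊆π u∼v)) v<i)

        v≢j : v ≢ j
        v≢j v≡j = m≁ρv (subst (m ∼⟨ ρ ⟩_) (sym v≡j) m∼ρj)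

        j≮v : ¬ j < v
        j≮v j<v = m≁ρu (∼-noncrossing ρ (ℕ.<-≤-trans m<i i≤u) u<j j<v m∼ρj u∼v)

    cut : Dec (∃ Next) → Cut
    cut (no ¬next) = cut-without-next ¬next
    cut (yes next) = let _ , (i<j , m∼ρj) , j-least = least next? next in
      cut-at-next i<j m∼ρj j-least

  some-outside : ∀ {x y m} → x ∼⟨ π ⟩ y → ¬ x ∼⟨ ρ ⟩ y → x ∼⟨ π ⟩ m →
                 ∃ λ z → m ∼⟨ π ⟩ z × ¬ m ∼⟨ ρ ⟩ z
  some-outside {x} {y} {m} x∼y x≁ρy x∼m with m ∼⟨ ρ ⟩? x | m ∼⟨ ρ ⟩? y
  ... | no m≁x  | _       = x , ∼-sym π x∼m , m≁x
  ... | yes _   | no m≁y  = y , ∼-trans π (∼-sym π x∼m) x∼y , m≁y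
  ... | yes m∼x | yes m∼y = contradiction (∼-trans ρ (∼-sym ρ m∼x) m∼y) x≁ρy

  cut-from : ∀ {m} → (∀ {x} → m ∼⟨ π ⟩ x → m ≤ x) →
    (∃ λ i → (m ∼⟨ π ⟩ i × ¬ m ∼⟨ ρ ⟩ i) × (∀ {x} → m ∼⟨ π ⟩ x × ¬ m ∼⟨ ρ ⟩ x → i ≤ x)) → Cut
  cut-from m-least (i , (m∼i , m≁ρi) , i-least) =
    cut m-least m∼i m≁ρi i-least (any? (next? m-least m∼i m≁ρi i-least))

  cut-pair : ∀ {x y} → x ∼⟨ π ⟩ y → ¬ x ∼⟨ ρ ⟩ y →
             (∃ λ m → x ∼⟨ π ⟩ m × (∀ {z} → x ∼⟨ π ⟩ z → m ≤ z)) → Cut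
  cut-pair x∼y x≁ρy (m , x∼m , m-least) =
    cut-from (λ m∼z → m-least (∼-trans π x∼m m∼z))
      (least (λ z → m ∼⟨ π ⟩? z ×-dec ¬? (m ∼⟨ ρ ⟩? z)) (some-outside x∼y x≁ρy x∼m))

  cut-block : (∃₂ λ x y → x ∼⟨ π ⟩ y × ¬ x ∼⟨ ρ ⟩ y) → Cut
  cut-block (x , y , x∼y , x≁ρy) = cut-pair x∼y x≁ρy (least (x ∼⟨ π ⟩?_) (x , ∼-refl π))

⋖⇒split : {ρ π : NC n} → ρ ⋖ π → ∃₂ λ i j → i < j × i ∼⟨ π ⟩ j × ρ ≡ split π i j
⋖⇒split {n} {ρ} {π} (ρ<π , nothing-between) = equal (below-split ρ<π)
  where
  equal : (∃₂ λ i j → i < j × i ∼⟨ π ⟩ j × (∀ {x y} → x ∼⟨ ρ ⟩ y → x ∼⟨ split π i j ⟩ y)) →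
          ∃₂ λ i j → i < j × i ∼⟨ π ⟩ j × ρ ≡ split π i j
  equal (i , j , i<j , i∼j , ρ⊆split) = i , j , i<j , i∼j ,
    decidable-stable (ρ ≟ₙ split π i j) λ ρ≢split →
      nothing-between (split π i j , (⊆⇒≤ₙ ρ⊆split , ρ≢split) , proj₁ (split-⋖ π i<j i∼j))

-- A cut can be read off from its result: the inner part is the one without the greatest element of
-- the block, i is its least element, and j is the next element of the block after it. The proof
-- compares two cuts directly.
split-injective : ∀ (π : NC n) {i j i′ j′} → i < j → i ∼⟨ π ⟩ j → i′ < j′ → i′ ∼⟨ π ⟩ j′ →
                  split π i j ≡ split π i′ j′ → i ≡ i′ × j ≡ j′
split-injective π i<j i∼j i′<j′ i′∼j′ eq =
  i≡i′ , toℕ-injective (ℕ.≤-antisym (ℕ.≮⇒≥ (end≮ i<j i∼j i′<j′ i′∼j′ eq i≡i′))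
                                      (ℕ.≮⇒≥ (end≮ i′<j′ i′∼j′ i<j i∼j (sym eq) (sym i≡i′))))
  where
  same-block : ∀ {i j i′ j′} → i < j → i ∼⟨ π ⟩ j → split π i j ≡ split π i′ j′ → i′ ∼⟨ π ⟩ i
  same-block {i} {j} {i′} {j′} i<j i∼j eq = decidable-stable (i′ ∼⟨ π ⟩? i) λ i′≁i →
    split-separates π i j (∼-refl π) (between-start i<j) ¬between-end
      (subst (i ∼⟨_⟩ j) (sym eq) (split-elsewhere π i′ j′ i′≁i i∼j))

  -- If i < i′, then i and j′ are both outside [i′, j′), hence in one part. This puts j′, and i′ <
  -- j′ with it, into [i, j), so the first cut joins i′ and j′ while the second separates them.
  start≮ : ∀ {i j i′ j′} → i < j → i ∼⟨ π ⟩ j → i′ < j′ → i′ ∼⟨ π ⟩ j′ →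
           split π i j ≡ split π i′ j′ → ¬ i < i′
  start≮ {i} {j} {i′} {j′} i<j i∼j i′<j′ i′∼j′ eq i<i′ =
    split-separates π i′ j′ (∼-refl π) (between-start i′<j′) ¬between-end
      (subst (i′ ∼⟨_⟩ j′) eq (split-inside π i j i′∼j′ between-i′ between-j′))
    where
    i′∼i = same-block i<j i∼j eq
    i∼j′ : i ∼⟨ split π i j ⟩ j′
    i∼j′ = subst (i ∼⟨_⟩ j′) (sym eq) (split-outside π i′ j′
      (∼-trans π (∼-sym π i′∼i) i′∼j′) (¬between-before i<i′) ¬between-end)
    between-j′ : Between i j j′
    between-j′ = proj₁ (proj₂ (split⁻ π i j i∼j′) (∼-refl π)) (between-start i<j)
    between-i′ : Between i j i′
    between-i′ = ℕ.<⇒≤ i<i′ , ℕ.<-trans i′<j′ (proj₂ between-j′)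

  i≡i′ = toℕ-injective (ℕ.≤-antisym (ℕ.≮⇒≥ (start≮ i′<j′ i′∼j′ i<j i∼j (sym eq)))
                                      (ℕ.≮⇒≥ (start≮ i<j i∼j i′<j′ i′∼j′ eq)))

  end≮ : ∀ {i j i′ j′} → i < j → i ∼⟨ π ⟩ j → i′ < j′ → i′ ∼⟨ π ⟩ j′ →
         split π i j ≡ split π i′ j′ → i ≡ i′ → ¬ j′ < j
  end≮ {i} {j} {i′} {j′} i<j i∼j i′<j′ i′∼j′ eq refl j′<j =
    split-separates π i j′ (∼-refl π) (between-start i′<j′) ¬between-end
      (subst (i ∼⟨_⟩ j′) eq (split-inside π i j i′∼j′ (between-start i<j) (ℕ.<⇒≤ i′<j′ , j′<j)))

-- Least elements of blocks and interval splits

IsMin : NC n → Fin n → Set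
IsMin π x = ∀ y → x ∼⟨ π ⟩ y → x ≤ y

isMin? : (π : NC n) → Decidable (IsMin π)
isMin? π x = all? λ y → x ∼⟨ π ⟩? y →-dec x ≤? y

⊏-blocks : {ρ π : NC n} → ρ ⊏ π → ∃₂ λ p q → p ∼⟨ π ⟩ q × ¬ p ∼⟨ ρ ⟩ q ×
  (lookup (blocks ρ) p ≪ lookup (blocks ρ) q ⊎ lookup (blocks ρ) q ≪ lookup (blocks ρ) p)
⊏-blocks {n} {ρ} {π} (_ , any₁) = find-r any₁
  where
  Blocks : Set
  Blocks = ∃₂ λ p q → p ∼⟨ π ⟩ q × ¬ p ∼⟨ ρ ⟩ q ×
    (lookup (blocks ρ) p ≪ lookup (blocks ρ) q ⊎ lookup (blocks ρ) q ≪ lookup (blocks ρ) p)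

  Pred₃ : Subset n → Subset n → Subset n → Set
  Pred₃ B B₁ B₂ = B₁ ≢ B₂ × B₁ ∪ B₂ ≡ B × (B₁ ≪ B₂ ⊎ B₂ ≪ B₁)

  found : ∀ r p q → Pred₃ (lookup (blocks π) r) (lookup (blocks ρ) p) (lookup (blocks ρ) q) → Blocks
  found r p q (B₁≢B₂ , union , order) = p , q
    , ∼-trans π (∼-sym π (r∼ (inj₁ (∈block (∼-refl ρ))))) (r∼ (inj₂ (∈block (∼-refl ρ))))
    , (λ p∼q → B₁≢B₂ (sym (∼-block ρ p∼q)))
    , order
    where
    r∼ : ∀ {x} → x ∈ₛ lookup (blocks ρ) p ⊎ x ∈ₛ lookup (blocks ρ) q → r ∼⟨ π ⟩ x
    r∼ {x} x∈ = member (subst (x ∈ₛ_) union (x∈p∪q⁺ x∈))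

  find-q : ∀ r p → Any (Pred₃ (lookup (blocks π) r) (lookup (blocks ρ) p)) (blocks ρ) → Blocks
  find-q r p any = found r p (Any.index any) (Any.lookup-index any)

  find-p : ∀ r → Any (λ B₁ → Any (Pred₃ (lookup (blocks π) r) B₁) (blocks ρ)) (blocks ρ) → Blocks
  find-p r any = find-q r (Any.index any) (Any.lookup-index any)

  find-r : Any (λ B → Any (λ B₁ → Any (Pred₃ B B₁) (blocks ρ)) (blocks ρ)) (blocks π) → Blocks
  find-r any = find-p (Any.index any) (Any.lookup-index any)

module _ (π : NC n) {i j : Fin n} (i<j : i < j) (i∼j : i ∼⟨ π ⟩ j) where

  private
    ρ : NC n
    ρ = split π i j

    i≁ρj : ¬ i ∼⟨ ρ ⟩ j
    i≁ρj = split-separates π i j (∼-refl π) (between-start i<j) ¬between-end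

  -- With i least in its block, the outer part has nothing below i and so lies entirely after the
  -- inner one.
  isMin⇒⊏ : IsMin π i → split π i j ⊏ π
  isMin⇒⊏ i-min = split-⋖ π i<j i∼j , any-at (blocks π) i (any-at (blocks ρ) i (any-at (blocks ρ) j
    ( (λ Bᵢ≡Bⱼ → i≁ρj (member (subst (j ∈ₛ_) (sym Bᵢ≡Bⱼ) (∈block (∼-refl ρ)))))
    , ⊆-antisym union⊆ ⊆union
    , inj₁ λ x y x∈i y∈j → below (member x∈i) (member y∈j) )))
    where
    union⊆ : ∀ {x} → x ∈ₛ lookup (blocks ρ) i ∪ lookup (blocks ρ) j → x ∈ₛ lookup (blocks π) i
    union⊆ x∈ with x∈p∪q⁻ _ _ x∈
    ... | inj₁ x∈i = ∈block (split⊆ π i j (member x∈i))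
    ... | inj₂ x∈j = ∈block (∼-trans π i∼j (split⊆ π i j (member x∈j)))

    ⊆union : ∀ {x} → x ∈ₛ lookup (blocks π) i → x ∈ₛ lookup (blocks ρ) i ∪ lookup (blocks ρ) j
    ⊆union {x} x∈i with between? i j x
    ... | yes bx = x∈p∪q⁺ (inj₁ (∈block (split-inside π i j (member x∈i) (between-start i<j) bx)))
    ... | no ¬bx = x∈p∪q⁺ (inj₂ (∈block (split-outside π i j
                     (∼-trans π (∼-sym π i∼j) (member x∈i)) ¬between-end ¬bx)))

    below : ∀ {x y} → i ∼⟨ ρ ⟩ x → j ∼⟨ ρ ⟩ y → x < y
    below {x} {y} i∼x j∼y = ℕ.<-≤-trans
      (proj₂ (proj₁ (proj₂ (split⁻ π i j i∼x) (∼-refl π)) (between-start i<j)))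
      (ℕ.≮⇒≥ λ y<j → ¬between-end (proj₂ (proj₂ (split⁻ π i j j∼y) i∼j)
        (i-min y (∼-trans π i∼j (split⊆ π i j j∼y)) , y<j)))

  -- An element k < i of the block would lie in the outer part together with j, so that i would have
  -- outer elements on both sides. The blocks supplied by the interval condition must be the two
  -- parts, since they are joined in `π` but not in the cut.
  ⊏⇒isMin : split π i j ⊏ π → IsMin π i
  ⊏⇒isMin ρ⊏π k i∼k = ℕ.≮⇒≥ λ k<i →
    let p , q , p∼q , p≁q , order = ⊏-blocks ρ⊏π in
    unordered k<i p∼q p≁q order (split-cases π i j p∼q)
    where
    inside-outside : ∀ {p q} → k < i → p ∼⟨ π ⟩ q → i ∼⟨ π ⟩ p → Between i j p → ¬ Between i j q →
                     p ∼⟨ ρ ⟩ i × q ∼⟨ ρ ⟩ k × q ∼⟨ ρ ⟩ j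
    inside-outside k<i p∼q i∼p bp ¬bq =
        split-inside π i j (∼-sym π i∼p) bp (between-start i<j)
      , split-outside π i j (∼-trans π q∼i i∼k) ¬bq (¬between-before k<i)
      , split-outside π i j (∼-trans π q∼i i∼j) ¬bq ¬between-end
      where q∼i = ∼-sym π (∼-trans π i∼p p∼q)

    not≪ : ∀ {p q} → k < i → p ∼⟨ ρ ⟩ i × q ∼⟨ ρ ⟩ k × q ∼⟨ ρ ⟩ j →
           ¬ (lookup (blocks ρ) p ≪ lookup (blocks ρ) q ⊎ lookup (blocks ρ) q ≪ lookup (blocks ρ) p)
    not≪ k<i (p∼i , q∼k , _) (inj₁ p≪q) = ℕ.<-asym k<i (p≪q i k (∈block p∼i) (∈block q∼k))
    not≪ k<i (p∼i , _ , q∼j) (inj₂ q≪p) = ℕ.<-asym i<j (q≪p j i (∈block q∼j) (∈block p∼i))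

    unordered : ∀ {p q} → k < i → p ∼⟨ π ⟩ q → ¬ p ∼⟨ ρ ⟩ q →
      (lookup (blocks ρ) p ≪ lookup (blocks ρ) q ⊎ lookup (blocks ρ) q ≪ lookup (blocks ρ) p) →
      ¬ (p ∼⟨ ρ ⟩ q ⊎ i ∼⟨ π ⟩ p ×
          (Between i j p × ¬ Between i j q ⊎ ¬ Between i j p × Between i j q))
    unordered k<i p∼q p≁q order (inj₁ p∼ρq)                    = p≁q p∼ρq
    unordered k<i p∼q p≁q order (inj₂ (i∼p , inj₁ (bp , ¬bq))) =
      not≪ k<i (inside-outside k<i p∼q i∼p bp ¬bq) order
    unordered k<i p∼q p≁q order (inj₂ (i∼p , inj₂ (¬bp , bq))) =
      not≪ k<i (inside-outside k<i (∼-sym π p∼q) (∼-trans π i∼p p∼q) bq ¬bp) (Sum.swap order)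

-- Block sizes

unique-↭ : {xs ys : List A} → Unique xs → Unique ys →
           (∀ {z} → z ∈ xs → z ∈ ys) → (∀ {z} → z ∈ ys → z ∈ xs) → xs ↭ ys
unique-↭ xs! ys! xs⊆ys ys⊆xs = ∼bag⇒↭ (unique∧set⇒bag xs! ys! (mk⇔ xs⊆ys ys⊆xs))

unique-map : {f : A → B} (xs : List A) →
  (∀ {x y} → x ∈ xs → y ∈ xs → f x ≡ f y → x ≡ y) → Unique xs → Unique (map f xs)
unique-map []       inj []          = []
unique-map (x ∷ xs) inj (x∉xs ∷ xs!) =
  AllL.map⁺ (AllL.tabulate λ y∈xs fx≡fy →
    AllL.lookup x∉xs y∈xs (inj (here refl) (there y∈xs) fx≡fy))
  ∷ unique-map xs (λ x∈ y∈ → inj (there x∈) (there y∈)) xs!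

unique-∷ : {x : A} {xs : List A} → x ∉ xs → Unique xs → Unique (x ∷ xs)
unique-∷ x∉xs xs! = AllL.tabulate (λ { y∈xs refl → x∉xs y∈xs }) ∷ xs!

unique-concatMap : {f : A → List B} (xs : List A) → Unique xs →
  (∀ {x} → x ∈ xs → Unique (f x)) →
  (∀ {x y z} → x ∈ xs → y ∈ xs → z ∈ f x → z ∈ f y → x ≡ y) →
  Unique (concatMap f xs)
unique-concatMap []       []          f! disjoint = []
unique-concatMap {f = f} (x ∷ xs) (x∉xs ∷ xs!) f! disjoint = Unique.++⁺ (f! (here refl))
  (unique-concatMap xs xs! (f! ∘ there) (λ x∈ y∈ → disjoint (there x∈) (there y∈)))
  λ (z∈fx , z∈rest) → apart z∈fx (∈-concatMap⁻ f z∈rest)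
  where
  apart : ∀ {z} → z ∈ f x → ¬ AnyL.Any ((z ∈_) ∘ f) xs
  apart z∈fx any =
    let y , y∈xs , z∈fy = find any in
    AllL.lookup x∉xs y∈xs (disjoint (here refl) (there y∈xs) z∈fx z∈fy)

∈-concatMap⇒ : (f : A → List B) (xs : List A) {z : B} →
               z ∈ concatMap f xs → ∃ λ x → x ∈ xs × z ∈ f x
∈-concatMap⇒ f xs z∈ = find (∈-concatMap⁻ f {xs = xs} z∈)

⇒∈-concatMap : (f : A → List B) {xs : List A} {x : A} {z : B} →
               x ∈ xs → z ∈ f x → z ∈ concatMap f xs
⇒∈-concatMap f x∈xs z∈fx = ∈-concatMap⁺ f (lose x∈xs z∈fx)

mins : NC n → List (Fin n)
mins {n} π = filter (isMin? π) (allFin n)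

above : NC n → Fin n → List (Fin n)
above {n} π x = filter (λ y → x ∼⟨ π ⟩? y ×-dec x <? y) (allFin n)

-- Sizes are lowered by one throughout, which turns compositions into weak ones;
-- size⁻ π x is meaningful only if x is the least element of its block.
size⁻ : NC n → Fin n → ℕ
size⁻ π x = length (above π x)

type : NC n → List ℕ
type π = map (size⁻ π) (mins π)

module _ {n} (π : NC n) where

  ∈-mins⁺ : ∀ {x} → IsMin π x → x ∈ mins π
  ∈-mins⁺ x-min = ∈-filter⁺ (isMin? π) (∈-allFin _) x-min

  ∈-mins⁻ : ∀ {x} → x ∈ mins π → IsMin π x
  ∈-mins⁻ x∈ = proj₂ (∈-filter⁻ (isMin? π) {xs = allFin n} x∈)

  mins! : Unique (mins π)
  mins! = Unique.filter⁺ (isMin? π) (Unique.allFin⁺ n)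

  ∈-above⁺ : ∀ {x y} → x ∼⟨ π ⟩ y → x < y → y ∈ above π x
  ∈-above⁺ {x} x∼y x<y = ∈-filter⁺ (λ y → x ∼⟨ π ⟩? y ×-dec x <? y) (∈-allFin _) (x∼y , x<y)

  ∈-above⁻ : ∀ {x y} → y ∈ above π x → x ∼⟨ π ⟩ y × x < y
  ∈-above⁻ {x} y∈ = proj₂ (∈-filter⁻ (λ y → x ∼⟨ π ⟩? y ×-dec x <? y) {xs = allFin n} y∈)

  above! : ∀ x → Unique (above π x)
  above! x = Unique.filter⁺ _ (Unique.allFin⁺ n)

  above-sorted : ∀ x → AllPairs _<_ (above π x)
  above-sorted x = AllPairs.filter⁺ _ (AllPairs.tabulate⁺-< id)

  isMin-unique : ∀ {x y} → IsMin π x → IsMin π y → x ∼⟨ π ⟩ y → x ≡ y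
  isMin-unique x-min y-min x∼y =
    toℕ-injective (ℕ.≤-antisym (x-min _ x∼y) (y-min _ (∼-sym π x∼y)))

  block-min : ∀ x → ∃ λ m → IsMin π m × m ∼⟨ π ⟩ x
  block-min x = let m , x∼m , m-least = least (x ∼⟨ π ⟩?_) (x , ∼-refl π) in
    m , (λ y m∼y → m-least (∼-trans π x∼m m∼y)) , ∼-sym π x∼m

-- The list of lower covers

later : NC n → Fin n → Fin n → List (Fin n)
later π m i = filter (i <?_) (above π m)

covers : NC n → List (NC n)
covers π = concatMap (λ m → concatMap (λ i → map (split π i) (later π m i)) (m ∷ above π m)) (mins π)

module _ {n} (π : NC n) where

  ∈-later⁻ : ∀ {m i j} → m ∼⟨ π ⟩ i → j ∈ later π m i → i < j × i ∼⟨ π ⟩ j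
  ∈-later⁻ {m} {i} m∼i j∈ =
    let j∈above , i<j = ∈-filter⁻ (i <?_) {xs = above π m} j∈ in
    i<j , ∼-trans π (∼-sym π m∼i) (proj₁ (∈-above⁻ π j∈above))

  ∈-block : ∀ {m i} → i ∈ m ∷ above π m → m ∼⟨ π ⟩ i
  ∈-block (here refl) = ∼-refl π
  ∈-block (there i∈)  = proj₁ (∈-above⁻ π i∈)

  covers! : Unique (covers π)
  covers! = unique-concatMap (mins π) (mins! π)
    (λ {m} m∈ → unique-concatMap (m ∷ above π m)
      (unique-∷ (λ m∈above → ℕ.<-irrefl refl (proj₂ (∈-above⁻ π m∈above))) (above! π m))
      (λ {i} i∈ → unique-map (later π m i) (λ x∈ y∈ eq → proj₂ (injective (∈-block i∈) x∈ (∈-block i∈) y∈ eq))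
        (Unique.filter⁺ (i <?_) (above! π m)))
      (λ x∈ y∈ z∈x z∈y → same-start (∈-block x∈) z∈x (∈-block y∈) z∈y))
    (λ {m} {m′} m∈ m′∈ ρ∈m ρ∈m′ →
      let i , i∈ , ρ∈i = ∈-concatMap⇒ (λ i → map (split π i) (later π m i)) (m ∷ above π m) ρ∈m
          i′ , i′∈ , ρ∈i′ = ∈-concatMap⇒ (λ i → map (split π i) (later π m′ i)) (m′ ∷ above π m′) ρ∈m′
          i≡i′ = same-start (∈-block i∈) ρ∈i (∈-block i′∈) ρ∈i′
      in isMin-unique π (∈-mins⁻ π m∈) (∈-mins⁻ π m′∈)
        (∼-trans π (∈-block i∈) (subst (_∼⟨ π ⟩ m′) (sym i≡i′) (∼-sym π (∈-block i′∈)))))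
    where
    injective : ∀ {m i j m′ i′ j′} → m ∼⟨ π ⟩ i → j ∈ later π m i → m′ ∼⟨ π ⟩ i′ → j′ ∈ later π m′ i′ →
                split π i j ≡ split π i′ j′ → i ≡ i′ × j ≡ j′
    injective m∼i j∈ m∼i′ j′∈ =
      let i<j , i∼j = ∈-later⁻ m∼i j∈ ; i′<j′ , i′∼j′ = ∈-later⁻ m∼i′ j′∈
      in split-injective π i<j i∼j i′<j′ i′∼j′

    same-start : ∀ {m i m′ i′ ρ} → m ∼⟨ π ⟩ i → ρ ∈ map (split π i) (later π m i) →
                 m′ ∼⟨ π ⟩ i′ → ρ ∈ map (split π i′) (later π m′ i′) → i ≡ i′
    same-start m∼i ρ∈ m′∼i′ ρ∈′ =
      let j , j∈ , eq = ∈-map⁻ _ ρ∈ ; j′ , j′∈ , eq′ = ∈-map⁻ _ ρ∈′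
      in proj₁ (injective m∼i j∈ m′∼i′ j′∈ (trans (sym eq) eq′))

  covers⇒⋖ : ∀ {ρ} → ρ ∈ covers π → ρ ⋖ π
  covers⇒⋖ {ρ} ρ∈ =
    let m , m∈ , ρ∈m = ∈-concatMap⇒ _ (mins π) ρ∈
        i , i∈ , ρ∈i = ∈-concatMap⇒ (λ i → map (split π i) (later π m i)) (m ∷ above π m) ρ∈m
        j , j∈ , eq  = ∈-map⁻ (split π i) ρ∈i
        i<j , i∼j    = ∈-later⁻ (∈-block i∈) j∈
    in subst (_⋖ π) (sym eq) (split-⋖ π i<j i∼j)

  ⋖⇒covers : ∀ {ρ} → ρ ⋖ π → ρ ∈ covers π
  ⋖⇒covers {ρ} ρ⋖π =
    let i , j , i<j , i∼j , eq = ⋖⇒split ρ⋖π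
        m , m-min , m∼i = block-min π i
        m≤i = m-min i m∼i
        m∼j = ∼-trans π m∼i i∼j
    in subst (_∈ covers π) (sym eq) (⇒∈-concatMap
         (λ m → concatMap (λ i → map (split π i) (later π m i)) (m ∷ above π m)) (∈-mins⁺ π m-min)
         (⇒∈-concatMap (λ i → map (split π i) (later π m i)) (in-block m-min m∼i)
           (∈-map⁺ (split π i) (∈-filter⁺ (i <?_) (∈-above⁺ π m∼j (ℕ.≤-<-trans m≤i i<j)) i<j))))
    where
    in-block : ∀ {m i} → IsMin π m → m ∼⟨ π ⟩ i → i ∈ m ∷ above π m
    in-block {m} {i} m-min m∼i with m ≟ i
    ... | yes refl = here refl
    ... | no m≢i   = there (∈-above⁺ π m∼i (≤∧≢⇒< (m-min i m∼i) m≢i))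

  covers-↭ : filter (_⋖? π) (allNC n) ↭ covers π
  covers-↭ = unique-↭ (Unique.filter⁺ (_⋖? π) (allNC-unique n)) covers!
    (λ ρ∈ → ⋖⇒covers (proj₂ (∈-filter⁻ (_⋖? π) {xs = allNC n} ρ∈)))
    (λ ρ∈ → ∈-filter⁺ (_⋖? π) (∈-allNC _) (covers⇒⋖ ρ∈))

-- How a cut changes the block sizes

_∖_ : List (Fin n) → Fin n → List (Fin n)
xs ∖ m = filter (λ x → ¬? (m ≟ x)) xs

∖-↭ : ∀ {xs} {m : Fin n} → Unique xs → m ∈ xs → xs ↭ m ∷ (xs ∖ m)
∖-↭ {xs = xs} {m} xs! m∈xs = unique-↭ xs!
  (unique-∷ (λ m∈ → proj₂ (∈-filter⁻ (λ x → ¬? (m ≟ x)) {xs = xs} m∈) refl) (Unique.filter⁺ _ xs!))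
  (λ {z} z∈ → to z z∈) λ where
    (here refl) → m∈xs
    (there z∈)  → proj₁ (∈-filter⁻ (λ x → ¬? (m ≟ x)) {xs = xs} z∈)
  where
  to : ∀ z → z ∈ xs → z ∈ m ∷ (xs ∖ m)
  to z z∈ with m ≟ z
  ... | yes refl = here refl
  ... | no m≢z   = there (∈-filter⁺ (λ x → ¬? (m ≟ x)) z∈ m≢z)

-- The least elements m and o of the two parts of the block split by ρ.
module _ {n} (π ρ : NC n) {m o : Fin n} (ρ⊆π : ∀ {x y} → x ∼⟨ ρ ⟩ y → x ∼⟨ π ⟩ y)
  (m-min : IsMin π m) (m∼o : m ∼⟨ π ⟩ o) (m≁o : ¬ m ∼⟨ ρ ⟩ o) (o-min : IsMin ρ o)
  (two-parts : ∀ {x} → m ∼⟨ π ⟩ x → m ∼⟨ ρ ⟩ x ⊎ o ∼⟨ ρ ⟩ x)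
  (elsewhere : ∀ {x y} → ¬ m ∼⟨ π ⟩ x → x ∼⟨ π ⟩ y → x ∼⟨ ρ ⟩ y)
  where

  private
    m<o : m < o
    m<o = ≤∧≢⇒< (m-min _ m∼o) λ { refl → m≁o (∼-refl ρ) }

    o∉mins : o ∉ mins π
    o∉mins o∈ = m≁o (subst (m ∼⟨ ρ ⟩_) (isMin-unique π m-min (∈-mins⁻ π o∈) m∼o) (∼-refl ρ))

    min-refine : ∀ {x} → IsMin π x → IsMin ρ x
    min-refine x-min y x∼y = x-min y (ρ⊆π x∼y)

    min-cases : ∀ {x} → IsMin ρ x → x ∈ o ∷ mins π
    min-cases {x} x-min with m ∼⟨ π ⟩? x
    ... | no m≁x  = there (∈-mins⁺ π (λ y x∼y → x-min y (elsewhere m≁x x∼y)))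
    ... | yes m∼x with two-parts m∼x
    ...   | inj₁ m∼ρx = there (∈-mins⁺ π
              (subst (IsMin π) (isMin-unique ρ (min-refine m-min) x-min m∼ρx) m-min))
    ...   | inj₂ o∼ρx = here (isMin-unique ρ x-min o-min (∼-sym ρ o∼ρx))

  mins-split : mins ρ ↭ o ∷ mins π
  mins-split = unique-↭ (mins! ρ) (unique-∷ o∉mins (mins! π)) (min-cases ∘ ∈-mins⁻ ρ) λ where
    (here refl) → ∈-mins⁺ ρ o-min
    (there x∈)  → ∈-mins⁺ ρ (min-refine (∈-mins⁻ π x∈))

  above-split : above π m ↭ o ∷ above ρ m ++ above ρ o
  above-split = unique-↭ (above! π m)
    (unique-∷ (λ o∈ → [ (λ o∈m → m≁o (proj₁ (∈-above⁻ ρ o∈m)))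
                      , (λ o∈o → ℕ.<-irrefl refl (proj₂ (∈-above⁻ ρ o∈o))) ] (∈-++⁻ (above ρ m) o∈))
      (Unique.++⁺ (above! ρ m) (above! ρ o) λ (x∈m , x∈o) →
        m≁o (∼-trans ρ (proj₁ (∈-above⁻ ρ x∈m)) (∼-sym ρ (proj₁ (∈-above⁻ ρ x∈o))))))
    (λ {x} x∈ → let m∼x , m<x = ∈-above⁻ π x∈ in to x m<x (two-parts m∼x))
    λ where
      (here refl) → ∈-above⁺ π m∼o m<o
      (there x∈)  → [ (λ x∈m → let m∼x , m<x = ∈-above⁻ ρ x∈m in ∈-above⁺ π (ρ⊆π m∼x) m<x)
                    , (λ x∈o → let o∼x , o<x = ∈-above⁻ ρ x∈o in
                        ∈-above⁺ π (∼-trans π m∼o (ρ⊆π o∼x)) (ℕ.<-trans m<o o<x))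
                    ] (∈-++⁻ (above ρ m) x∈)
    where
    to : ∀ x → m < x → m ∼⟨ ρ ⟩ x ⊎ o ∼⟨ ρ ⟩ x → x ∈ o ∷ above ρ m ++ above ρ o
    to x m<x (inj₁ m∼x) = there (∈-++⁺ˡ (∈-above⁺ ρ m∼x m<x))
    to x m<x (inj₂ o∼x) with o ≟ x
    ... | yes refl = here refl
    ... | no o≢x   = there (∈-++⁺ʳ (above ρ m) (∈-above⁺ ρ o∼x (≤∧≢⇒< (o-min x o∼x) o≢x)))

  -- The successor stands for o, which becomes a least element and is no longer counted above one.
  size⁻-split : size⁻ π m ≡ suc (size⁻ ρ m + size⁻ ρ o)
  size⁻-split = trans (↭-length above-split) (cong suc (length-++ (above ρ m)))

  type-split : type ρ ↭ size⁻ ρ o ∷ size⁻ ρ m ∷ map (size⁻ π) (mins π ∖ m)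
  type-split = ↭-trans (↭-map⁺ (size⁻ ρ) (↭-trans mins-split (↭.prep o (∖-↭ (mins! π) (∈-mins⁺ π m-min)))))
    (↭.prep _ (↭.prep _ (↭-reflexive (map-cong-∈ (mins π ∖ m) unchanged))))
    where
    map-cong-∈ : ∀ {f g : Fin n → ℕ} xs → (∀ {x} → x ∈ xs → f x ≡ g x) → map f xs ≡ map g xs
    map-cong-∈ []       eq = refl
    map-cong-∈ (x ∷ xs) eq = cong₂ _∷_ (eq (here refl)) (map-cong-∈ xs (eq ∘ there))

    unchanged : ∀ {x} → x ∈ mins π ∖ m → size⁻ ρ x ≡ size⁻ π x
    unchanged {x} x∈ =
      let x∈mins , m≢x = ∈-filter⁻ (λ x → ¬? (m ≟ x)) {xs = mins π} x∈
          m≁x = λ m∼x → m≢x (isMin-unique π m-min (∈-mins⁻ π x∈mins) m∼x)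
      in ↭-length (unique-↭ (above! ρ x) (above! π x)
        (λ y∈ → let x∼y , x<y = ∈-above⁻ ρ y∈ in ∈-above⁺ π (ρ⊆π x∼y) x<y)
        (λ y∈ → let x∼y , x<y = ∈-above⁻ π y∈ in ∈-above⁺ ρ (elsewhere m≁x x∼y) x<y))

module _ {n} (π : NC n) {m i j : Fin n} (m-min : IsMin π m) (m∼i : m ∼⟨ π ⟩ i)
  (i<j : i < j) (i∼j : i ∼⟨ π ⟩ j) where

  private
    ρ : NC n
    ρ = split π i j

    inner : ℕ
    inner = length (filter (_<? j) (later π m i))

    size⁻-inner : size⁻ ρ i ≡ inner
    size⁻-inner = ↭-length (unique-↭ (above! ρ i)
      (Unique.filter⁺ (_<? j) (Unique.filter⁺ (i <?_) (above! π m)))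
      (λ x∈ → let i∼x , i<x = ∈-above⁻ ρ x∈
                  i∼πx , same = split⁻ π i j i∼x
                  _ , x<j = proj₁ (same (∼-refl π)) (between-start i<j)
              in ∈-filter⁺ (_<? j) (∈-filter⁺ (i <?_) (∈-above⁺ π (∼-trans π m∼i i∼πx)
                   (ℕ.≤-<-trans (m-min i m∼i) i<x)) i<x) x<j)
      (λ x∈ → let x∈later , x<j = ∈-filter⁻ (_<? j) {xs = later π m i} x∈
                  i<x , i∼x = ∈-later⁻ π m∼i x∈later
              in ∈-above⁺ ρ (split-inside π i j i∼x (between-start i<j) (ℕ.<⇒≤ i<x , x<j)) i<x))

    i-min : IsMin ρ i
    i-min x i∼x = proj₁ (proj₁ (proj₂ (split⁻ π i j i∼x) (∼-refl π)) (between-start i<j))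

    i≁j : ¬ i ∼⟨ ρ ⟩ j
    i≁j = split-separates π i j (∼-refl π) (between-start i<j) ¬between-end

    parts : ∀ {x} → i ∼⟨ π ⟩ x → i ∼⟨ ρ ⟩ x ⊎ j ∼⟨ ρ ⟩ x
    parts {x} i∼x with between? i j x
    ... | yes bx = inj₁ (split-inside π i j i∼x (between-start i<j) bx)
    ... | no ¬bx = inj₂ (split-outside π i j (∼-trans π (∼-sym π i∼j) i∼x) ¬between-end ¬bx)

    outer : ∀ {p} → size⁻ π m ≡ suc (inner + p) → p ≡ size⁻ π m ∸ suc inner
    outer {p} eq = sym (trans (cong (_∸ suc inner) eq) (ℕ.m+n∸m≡n inner p))

    elsewhere : ∀ {x y} → ¬ m ∼⟨ π ⟩ x → x ∼⟨ π ⟩ y → x ∼⟨ ρ ⟩ y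
    elsewhere m≁x = split-elsewhere π i j (m≁x ∘ ∼-trans π m∼i)

  -- If i is m, the inner part keeps m and j is the new least element; otherwise the outer part
  -- keeps m and i is new. In both cases the list depends on j only through `inner`, so a sum over j
  -- can become a sum over inner sizes.
  split-type : type (split π i j) ↭ inner ∷ (size⁻ π m ∸ suc inner) ∷ map (size⁻ π) (mins π ∖ m)
  split-type with m ≟ i
  ... | yes refl = ↭-trans (type-split π ρ (split⊆ π i j) m-min i∼j i≁j j-min parts elsewhere)
    (↭-trans (↭.swap _ _ ↭-refl) (↭-reflexive (cong₂ (λ a b → a ∷ b ∷ _) size⁻-inner
      (outer (trans (size⁻-split π ρ (split⊆ π i j) m-min i∼j i≁j j-min parts elsewhere)
        (cong (λ a → suc (a + size⁻ ρ j)) size⁻-inner))))))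
    where
    j-min : IsMin ρ j
    j-min x j∼x = ℕ.≮⇒≥ λ x<j →
      let j∼πx , same = split⁻ π i j j∼x
      in ¬between-end (proj₂ (same i∼j) (m-min x (∼-trans π i∼j j∼πx) , x<j))
  ... | no m≢i = ↭-trans (type-split π ρ (split⊆ π i j) m-min m∼i m≁i i-min parts′ elsewhere)
    (↭-reflexive (cong₂ (λ a b → a ∷ b ∷ _) size⁻-inner
      (outer (trans (size⁻-split π ρ (split⊆ π i j) m-min m∼i m≁i i-min parts′ elsewhere)
        (cong suc (trans (ℕ.+-comm (size⁻ ρ m) _) (cong (_+ size⁻ ρ m) size⁻-inner)))))))
    where
    m≁i : ¬ m ∼⟨ ρ ⟩ i
    m≁i m∼ρi = m≢i (toℕ-injective (ℕ.≤-antisym (m-min i m∼i) (i-min m (∼-sym ρ m∼ρi))))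

    m∼j : m ∼⟨ ρ ⟩ j
    m∼j = [ (λ i∼m → contradiction (∼-sym ρ i∼m) m≁i) , ∼-sym ρ ]′ (parts (∼-sym π m∼i))

    parts′ : ∀ {x} → m ∼⟨ π ⟩ x → m ∼⟨ ρ ⟩ x ⊎ i ∼⟨ ρ ⟩ x
    parts′ m∼x = [ inj₂ , (λ j∼x → inj₁ (∼-trans ρ m∼j j∼x)) ]′ (parts (∼-trans π (∼-sym π m∼i) m∼x))

-- Sums over covers and over chains

∑-downFrom-suc : ∀ (G : ℕ → ℚ[X]) s → ∑ (downFrom (suc s)) G ≈ G 0 +ₚ ∑ (downFrom s) (λ p → G (suc p))
∑-downFrom-suc G zero    = ≈-refl
∑-downFrom-suc G (suc s) = begin
  G (suc s) +ₚ ∑ (downFrom (suc s)) G                       ≈⟨ +-congˡ (∑-downFrom-suc G s) ⟩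
  G (suc s) +ₚ (G 0 +ₚ ∑ (downFrom s) (λ p → G (suc p)))    ≈⟨ +ₚ-assoc _ _ _ ⟨
  G (suc s) +ₚ G 0 +ₚ ∑ (downFrom s) (λ p → G (suc p))      ≈⟨ +-congʳ (+ₚ-comm _ _) ⟩
  G 0 +ₚ G (suc s) +ₚ ∑ (downFrom s) (λ p → G (suc p))      ≈⟨ +ₚ-assoc _ _ _ ⟩
  G 0 +ₚ (G (suc s) +ₚ ∑ (downFrom s) (λ p → G (suc p)))    ∎

-- In a sorted list the numbers of smaller entries are the ranks 0, 1, 2 and so on, each taken once.
-- Applied to the end points j, the rank is the lowered inner size.
∑-#< : ∀ (G : ℕ → ℚ[X]) {ys : List (Fin n)} → AllPairs _<_ ys →
       ∑ ys (λ j → G (length (filter (_<? j) ys))) ≈ ∑ (downFrom (length ys)) G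
∑-#< G []                   = ≈-refl
∑-#< G {y ∷ ys} (y< ∷ ys<) = begin
  G (length (filter (_<? y) (y ∷ ys))) +ₚ ∑ ys (λ j → G (length (filter (_<? j) (y ∷ ys))))
    ≈⟨ +ₚ-cong
        (reflexive (cong (G ∘ length) (filter-none (_<? y)
          (ℕ.<-irrefl refl AllL.∷ AllL.map ℕ.<-asym y<))))
        (∑-cong ys λ {j} j∈ → reflexive (cong (G ∘ length) (filter-accept (_<? j) (AllL.lookup y< j∈)))) ⟩
  G 0 +ₚ ∑ ys (λ j → G (suc (length (filter (_<? j) ys))))
    ≈⟨ +-congˡ (∑-#< (λ p → G (suc p)) ys<) ⟩
  G 0 +ₚ ∑ (downFrom (length ys)) (λ p → G (suc p))
    ≈⟨ ∑-downFrom-suc G (length ys) ⟨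
  ∑ (downFrom (suc (length ys))) G ∎

∑-#> : ∀ (G : ℕ → ℚ[X]) {ys : List (Fin n)} → AllPairs _<_ ys →
       ∑ ys (λ i → G (length (filter (i <?_) ys))) ≈ ∑ (downFrom (length ys)) G
∑-#> G []                   = ≈-refl
∑-#> G {y ∷ ys} (y< ∷ ys<) = +ₚ-cong
  (reflexive (cong (G ∘ length) (trans (filter-reject (y <?_) (ℕ.<-irrefl refl)) (filter-all (y <?_) y<))))
  (≈-trans
    (∑-cong ys λ {i} i∈ → reflexive (cong (G ∘ length) (filter-reject (i <?_) (ℕ.<-asym (AllL.lookup y< i∈)))))
    (∑-#> G ys<))

-- For fixed p there are s - 1 - p values t with p < t < s. This is the origin of the coefficient c
-- in 1 + c x: with t elements after the start i, an inner part of lowered size p fits if p < t, and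
-- s - 1 - p is the lowered outer size.
∑-triangle : ∀ (G : ℕ → ℚ[X]) s → ∑ (downFrom s) (λ t → ∑ (downFrom t) G) ≈
             ∑ (downFrom s) (λ p → natₚ (s ∸ suc p) *ₚ G p)
∑-triangle G zero    = ≈-refl
∑-triangle G (suc s) = begin
  ∑ (downFrom s) G +ₚ ∑ (downFrom s) (λ t → ∑ (downFrom t) G)
    ≈⟨ +-congˡ (∑-triangle G s) ⟩
  ∑ (downFrom s) G +ₚ ∑ (downFrom s) (λ p → natₚ (s ∸ suc p) *ₚ G p)
    ≈⟨ ∑-+ _ _ (downFrom s) ⟨
  ∑ (downFrom s) (λ p → G p +ₚ natₚ (s ∸ suc p) *ₚ G p)
    ≈⟨ ∑-cong (downFrom s) (λ {p} p∈ → ≈-trans (≈-sym (natₚ-suc* (s ∸ suc p) (G p)))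
         (*-congʳ (reflexive (cong natₚ (sym (ℕ.+-∸-assoc 1 (∈-downFrom⁻ p∈))))))) ⟩
  ∑ (downFrom s) (λ p → natₚ (s ∸ p) *ₚ G p)
    ≈⟨ +ₚ-identityˡ _ ⟨
  -- The missing term p = s has coefficient s - s, so it can be added to complete the range.
  0ₚ +ₚ ∑ (downFrom s) (λ p → natₚ (s ∸ p) *ₚ G p)
    ≈⟨ +-congʳ (≈-trans (*-congʳ (reflexive (cong natₚ (ℕ.n∸n≡0 s)))) (*ₚ-zeroˡ _)) ⟨
  natₚ (s ∸ s) *ₚ G s +ₚ ∑ (downFrom s) (λ p → natₚ (s ∸ p) *ₚ G p) ∎

∑-downFrom-∑ₐ : ∀ f s → ∑ (downFrom (suc s)) (λ p → f p (s ∸ p)) ≈ ∑ₐ s f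
∑-downFrom-∑ₐ f zero    = ≈-refl
∑-downFrom-∑ₐ f (suc s) = begin
  ∑ (downFrom (suc (suc s))) (λ p → f p (suc s ∸ p))
    ≈⟨ ∑-downFrom-suc (λ p → f p (suc s ∸ p)) (suc s) ⟩
  f 0 (suc s) +ₚ ∑ (downFrom (suc s)) (λ p → f (suc p) (s ∸ p))
    ≈⟨ +-congˡ (∑-downFrom-∑ₐ (λ p q → f (suc p) q) s) ⟩
  f 0 (suc s) +ₚ ∑ₐ s (λ p q → f (suc p) q)
    ≈⟨ ∑ₐ-suc f s ⟨
  ∑ₐ (suc s) f ∎

∑-downFrom-∑ₐ⁻ : ∀ f s → ∑ (downFrom s) (λ p → f p (s ∸ suc p)) ≈ ∑ₐ⁻ s (λ p q → f q p)
∑-downFrom-∑ₐ⁻ f zero    = ≈-refl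
∑-downFrom-∑ₐ⁻ f (suc s) = ≈-trans (∑-downFrom-∑ₐ f s) (∑ₐ-comm f s)

-- `splits` cuts each part in its place, after the parts that precede it, while a sum over blocks
-- puts the two new parts in front; symmetry of `f` reconciles the two.
splits-map : ∀ {x f} (r : Fin n → ℕ) {ms} → Unique ms → Symmetric f →
  splits x f (map r ms) ≈
  ∑ ms (λ m → ∑ₐ⁻ (r m) (λ c a → (1ₚ +ₚ natₚ c *ₚ x) *ₚ f (c ∷ a ∷ map r (ms ∖ m))))
splits-map r []                    f-sym = ≈-refl
splits-map {f = f} r {m ∷ ms} (m∉ms ∷ ms!) f-sym = +ₚ-cong
  (∑ₐ⁻-cong (r m) λ c a → *-congˡ (reflexive (cong (λ l → f (c ∷ a ∷ map r l))
    (sym (trans (filter-reject (λ x → ¬? (m ≟ x)) (λ m≢m → m≢m refl))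
                    (filter-all (λ x → ¬? (m ≟ x)) m∉ms))))))
  (≈-trans (splits-map r ms! (Symmetric-∷ f-sym (r m)))
    (∑-cong ms λ {m′} m′∈ → ∑ₐ⁻-cong (r m′) λ c a → *-congˡ
      (≈-trans (f-sym (↭-trans (↭.swap _ _ ↭-refl) (↭.prep c (↭.swap _ _ ↭-refl))))
        (reflexive (cong (λ l → f (c ∷ a ∷ map r l))
          (sym (filter-accept (λ x → ¬? (m′ ≟ x)) (λ m′≡m → AllL.lookup m∉ms m′∈ (sym m′≡m)))))))))

module _ {n} (π : NC n) (x : ℚ[X]) {f : List ℕ → ℚ[X]} (f-sym : Symmetric f) where

  private
    weighted : NC n → ℚ[X]
    weighted ρ = (if does (ρ ⊏? π) then 1ₚ else x) *ₚ f (type ρ)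

    module _ {m} (m-min : IsMin π m) where

      s : ℕ
      s = size⁻ π m

      F : ℕ → ℚ[X]
      F p = f (p ∷ s ∸ suc p ∷ map (size⁻ π) (mins π ∖ m))

      type-later : ∀ {i j} → m ∼⟨ π ⟩ i → j ∈ later π m i →
                   f (type (split π i j)) ≈ F (length (filter (_<? j) (later π m i)))
      type-later m∼i j∈ = let i<j , i∼j = ∈-later⁻ π m∼i j∈ in f-sym (split-type π m-min m∼i i<j i∼j)

      later-sorted : ∀ i → AllPairs _<_ (later π m i)
      later-sorted i = AllPairs.filter⁺ (i <?_) (above-sorted π m)

      later-m : later π m m ≡ above π m
      later-m = filter-all (m <?_) (AllL.tabulate λ y∈ → proj₂ (∈-above⁻ π y∈))

      from-min : ∑ (later π m m) (λ j → weighted (split π m j)) ≈ ∑ (downFrom s) F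
      from-min = begin
        ∑ (later π m m) (λ j → weighted (split π m j))
          ≈⟨ ∑-cong (later π m m) (λ {j} j∈ → let i<j , i∼j = ∈-later⁻ π (∼-refl π) j∈ in
               ≈-trans (*ₚ-cong (reflexive (cong (if_then 1ₚ else x)
                 (dec-true (split π m j ⊏? π) (isMin⇒⊏ π i<j i∼j m-min)))) (type-later (∼-refl π) j∈))
               (*ₚ-identityˡ _)) ⟩
        ∑ (later π m m) (λ j → F (length (filter (_<? j) (later π m m))))
          ≈⟨ ∑-#< F (later-sorted m) ⟩
        ∑ (downFrom (length (later π m m))) F
          ≡⟨ cong (λ l → ∑ (downFrom (length l)) F) later-m ⟩
        ∑ (downFrom s) F ∎

      from-above : ∀ {i} → i ∈ above π m → ∑ (later π m i) (λ j → weighted (split π i j)) ≈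
                   x *ₚ ∑ (downFrom (length (later π m i))) F
      from-above {i} i∈ = begin
        ∑ (later π m i) (λ j → weighted (split π i j))
          ≈⟨ ∑-cong (later π m i) (λ {j} j∈ → let i<j , i∼j = ∈-later⁻ π m∼i j∈ in
               *ₚ-cong (reflexive (cong (if_then 1ₚ else x)
                 (dec-false (split π i j ⊏? π) λ ⊏π →
                   ℕ.<⇒≱ m<i (⊏⇒isMin π i<j i∼j ⊏π m (∼-sym π m∼i)))))
                 (type-later m∼i j∈)) ⟩
        ∑ (later π m i) (λ j → x *ₚ F (length (filter (_<? j) (later π m i))))
          ≈⟨ ∑-*ˡ x _ (later π m i) ⟩
        x *ₚ ∑ (later π m i) (λ j → F (length (filter (_<? j) (later π m i))))
          ≈⟨ *-congˡ (∑-#< F (later-sorted i)) ⟩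
        x *ₚ ∑ (downFrom (length (later π m i))) F ∎
        where
        m∼i = proj₁ (∈-above⁻ π i∈)
        m<i = proj₂ (∈-above⁻ π i∈)

      -- For each lowered inner size p there is one cut starting at m, which is an interval split of
      -- weight 1, and there are s - 1 - p cuts starting above m, each of weight `x`.
      from-block : ∑ (m ∷ above π m) (λ i → ∑ (later π m i) (λ j → weighted (split π i j))) ≈
        ∑ₐ⁻ s (λ c a → (1ₚ +ₚ natₚ c *ₚ x) *ₚ f (c ∷ a ∷ map (size⁻ π) (mins π ∖ m)))
      from-block = begin
        ∑ (m ∷ above π m) (λ i → ∑ (later π m i) (λ j → weighted (split π i j)))
          ≈⟨ +ₚ-cong from-min (∑-cong (above π m) from-above) ⟩
        ∑ (downFrom s) F +ₚ ∑ (above π m) (λ i → x *ₚ ∑ (downFrom (length (later π m i))) F)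
          ≈⟨ +-congˡ (≈-trans (∑-*ˡ x _ (above π m))
               (*-congˡ (∑-#> (λ t → ∑ (downFrom t) F) (above-sorted π m)))) ⟩
        ∑ (downFrom s) F +ₚ x *ₚ ∑ (downFrom s) (λ t → ∑ (downFrom t) F)
          ≈⟨ +-congˡ (*-congˡ (∑-triangle F s)) ⟩
        ∑ (downFrom s) F +ₚ x *ₚ ∑ (downFrom s) (λ p → natₚ (s ∸ suc p) *ₚ F p)
          ≈⟨ +-congˡ (∑-*ˡ x _ (downFrom s)) ⟨
        ∑ (downFrom s) F +ₚ ∑ (downFrom s) (λ p → x *ₚ (natₚ (s ∸ suc p) *ₚ F p))
          ≈⟨ ∑-+ _ _ (downFrom s) ⟨
        ∑ (downFrom s) (λ p → F p +ₚ x *ₚ (natₚ (s ∸ suc p) *ₚ F p))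
          ≈⟨ ∑-cong (downFrom s) (λ _ → ≈-trans
               (+ₚ-cong (≈-sym (*ₚ-identityˡ _)) (≈-trans (≈-sym (*ₚ-assoc _ _ _)) (*-congʳ (*ₚ-comm _ _))))
               (≈-sym (distribʳ _ _ _))) ⟩
        ∑ (downFrom s) (λ p → (1ₚ +ₚ natₚ (s ∸ suc p) *ₚ x) *ₚ F p)
          ≈⟨ ∑-downFrom-∑ₐ⁻ (λ p q → (1ₚ +ₚ natₚ q *ₚ x) *ₚ f (p ∷ q ∷ map (size⁻ π) (mins π ∖ m))) s ⟩
        ∑ₐ⁻ s (λ c a → (1ₚ +ₚ natₚ c *ₚ x) *ₚ f (a ∷ c ∷ map (size⁻ π) (mins π ∖ m)))
          ≈⟨ ∑ₐ⁻-cong s (λ c a → *-congˡ (f-sym (↭.swap a c ↭-refl))) ⟩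
        ∑ₐ⁻ s (λ c a → (1ₚ +ₚ natₚ c *ₚ x) *ₚ f (c ∷ a ∷ map (size⁻ π) (mins π ∖ m))) ∎

  ∑-covers : ∑ (filter (_⋖? π) (allNC n)) (λ ρ → (if does (ρ ⊏? π) then 1ₚ else x) *ₚ f (type ρ))
             ≈ splits x f (type π)
  ∑-covers = begin
    ∑ (filter (_⋖? π) (allNC n)) weighted
      ≈⟨ ∑-↭ weighted (covers-↭ π) ⟩
    ∑ (covers π) weighted
      ≈⟨ ∑-concatMap weighted _ (mins π) ⟩
    ∑ (mins π) (λ m → ∑ (concatMap (λ i → map (split π i) (later π m i)) (m ∷ above π m)) weighted)
      ≈⟨ ∑-cong (mins π) (λ {m} m∈ → ≈-trans (∑-concatMap weighted (λ i → map (split π i) (later π m i)) (m ∷ above π m))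
           (≈-trans (∑-cong (m ∷ above π m) (λ {i} _ → ∑-map weighted (split π i) (later π m i)))
             (from-block (∈-mins⁻ π m∈)))) ⟩
    ∑ (mins π) (λ m → ∑ₐ⁻ (size⁻ π m) (λ c a → (1ₚ +ₚ natₚ c *ₚ x) *ₚ f (c ∷ a ∷ map (size⁻ π) (mins π ∖ m))))
      ≈⟨ splits-map (size⁻ π) (mins! π) f-sym ⟨
    splits x f (type π) ∎

∑-chains : ∀ n k → (List ℕ → ℚ[X]) → ℚ[X]
∑-chains n k f = ∑ (finalChains n (suc k)) (λ Π → wt Π *ₚ f (type (Vec.head Π)))

∼1̂ : ∀ {x y : Fin n} → x ∼⟨ 1̂ ⟩ y
∼1̂ {x = x} {y} = member (subst (λ B → y ∈ₛ B) (sym (lookup-replicate x ⊤)) ∈⊤)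

type-1̂ : ∀ n → type (1̂ {suc n}) ↭ n ∷ []
type-1̂ n = ↭-trans (↭-map⁺ (size⁻ 1̂) mins-1̂) (↭-reflexive (cong (_∷ []) size⁻-1̂))
  where
  mins-1̂ : mins (1̂ {suc n}) ↭ zero ∷ []
  mins-1̂ = unique-↭ (mins! (1̂ {suc n})) (AllL.[] ∷ [])
    (λ x∈ → here (toℕ-injective (ℕ.n≤0⇒n≡0 (∈-mins⁻ 1̂ x∈ zero ∼1̂))))
    λ where (here refl) → ∈-mins⁺ 1̂ (λ _ _ → ℕ.z≤n)

  size⁻-1̂ : size⁻ (1̂ {suc n}) zero ≡ n
  size⁻-1̂ = trans
    (↭-length (unique-↭ (above! (1̂ {suc n}) zero) (Unique.tabulate⁺ suc-injective)
      (λ {y} y∈ → positive y (proj₂ (∈-above⁻ 1̂ y∈)))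
      (λ y∈ → let i , eq = ∈-tabulate⁻ y∈ in
        subst (_∈ above 1̂ zero) (sym eq) (∈-above⁺ 1̂ ∼1̂ ℕ.z<s))))
    (length-tabulate suc)
    where
    positive : ∀ y → zero {n} < y → y ∈ List.tabulate suc
    positive (suc y) _ = ∈-tabulate⁺ y

∑-chains-zero : ∀ n {f} → Symmetric f → ∑-chains (suc n) 0 f ≈ f (n ∷ [])
∑-chains-zero n {f} f-sym = begin
  ∑-chains (suc n) 0 f
    ≈⟨ ∑-filter isFinalChain? _ (vectors (allNC (suc n)) 1) ⟩
  ∑ (vectors (allNC (suc n)) 1) (λ Π → if does (isFinalChain? Π) then wt Π *ₚ f (type (Vec.head Π)) else 0ₚ)
    ≈⟨ ∑-cartesianProductWith _∷_ _ (allNC (suc n)) ([] ∷ []) ⟩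
  ∑ (allNC (suc n)) (λ π → (if does (π ≟ₙ 1̂) then 1ₚ *ₚ f (type π) else 0ₚ) +ₚ 0ₚ)
    ≈⟨ ∑-cong (allNC (suc n)) (λ _ → +-identityʳ _) ⟩
  ∑ (allNC (suc n)) (λ π → if does (π ≟ₙ 1̂) then 1ₚ *ₚ f (type π) else 0ₚ)
    ≈⟨ ∑-filter (_≟ₙ 1̂) _ (allNC (suc n)) ⟨
  ∑ (filter (_≟ₙ 1̂) (allNC (suc n))) (λ π → 1ₚ *ₚ f (type π))
    ≈⟨ ∑-↭ _ only-1̂ ⟩
  1ₚ *ₚ f (type (1̂ {suc n})) +ₚ 0ₚ
    ≈⟨ ≈-trans (+-identityʳ _) (*ₚ-identityˡ _) ⟩
  f (type (1̂ {suc n}))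
    ≈⟨ f-sym (type-1̂ n) ⟩
  f (n ∷ []) ∎
  where
  only-1̂ : filter (_≟ₙ 1̂) (allNC (suc n)) ↭ 1̂ ∷ []
  only-1̂ = unique-↭ (Unique.filter⁺ (_≟ₙ 1̂) (allNC-unique (suc n))) (AllL.[] ∷ [])
    (λ π∈ → here (proj₂ (∈-filter⁻ (_≟ₙ 1̂) {xs = allNC (suc n)} π∈)))
    λ where (here refl) → ∈-filter⁺ (_≟ₙ 1̂) (∈-allNC 1̂) refl

-- The order of summation is exchanged so that the finest entry ρ runs over the lower covers of the
-- head of a fixed tail. The weight of the tail factors out, and `∑-covers` evaluates the rest.
∑-chains-suc : ∀ n k {f} → Symmetric f →
  ∑-chains n (suc k) f ≈ ∑-chains n k (splits (X (n ∸ suc (suc k))) f)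
∑-chains-suc n k {f} f-sym = begin
  ∑-chains n (suc k) f
    ≈⟨ ∑-filter isFinalChain? weight (vectors (allNC n) (suc (suc k))) ⟩
  ∑ (vectors (allNC n) (suc (suc k))) (λ Π → if does (isFinalChain? Π) then weight Π else 0ₚ)
    ≈⟨ ∑-cartesianProductWith _∷_ _ (allNC n) (vectors (allNC n) (suc k)) ⟩
  ∑ (allNC n) (λ ρ → ∑ (vectors (allNC n) (suc k)) (λ Π → extend ρ Π))
    ≈⟨ ∑-swap extend (allNC n) (vectors (allNC n) (suc k)) ⟩
  ∑ (vectors (allNC n) (suc k)) (λ Π → ∑ (allNC n) (λ ρ → extend ρ Π))
    ≈⟨ ∑-cong (vectors (allNC n) (suc k)) (λ {Π} _ → ∑-extend Π) ⟩
  ∑ (vectors (allNC n) (suc k)) (λ Π →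
    if does (isFinalChain? Π) then wt Π *ₚ splits w f (type (Vec.head Π)) else 0ₚ)
    ≈⟨ ∑-filter isFinalChain? _ (vectors (allNC n) (suc k)) ⟨
  ∑-chains n k (splits w f) ∎
  where
  w : ℚ[X]
  w = X (n ∸ suc (suc k))

  weight : Vec (NC n) (suc (suc k)) → ℚ[X]
  weight Π = wt Π *ₚ f (type (Vec.head Π))

  extend : NC n → Vec (NC n) (suc k) → ℚ[X]
  extend ρ Π = if does (isFinalChain? (ρ ∷ Π)) then weight (ρ ∷ Π) else 0ₚ

  -- The test for a chain is the conjunction of the covering test for ρ and the test for the tail;
  -- the latter is constant in the sum over ρ.
  guarded : ∀ (a : NC n → Bool) (b : Bool) p (q : NC n → ℚ[X]) →
    ∑ (allNC n) (λ ρ → if a ρ then q ρ else 0ₚ) ≈ p →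
    ∑ (allNC n) (λ ρ → if a ρ ∧ b then q ρ else 0ₚ) ≈ (if b then p else 0ₚ)
  guarded a true  p q eq = ≈-trans (∑-cong (allNC n) (λ {ρ} _ →
    reflexive (cong (if_then q ρ else 0ₚ) (∧-identityʳ (a ρ))))) eq
  guarded a false p q eq = ≈-trans (∑-cong (allNC n) (λ {ρ} _ →
    reflexive (cong (if_then q ρ else 0ₚ) (∧-zeroʳ (a ρ))))) (∑-0 (allNC n))

  ∑-extend : ∀ Π → ∑ (allNC n) (λ ρ → extend ρ Π) ≈
    (if does (isFinalChain? Π) then wt Π *ₚ splits w f (type (Vec.head Π)) else 0ₚ)
  ∑-extend (π ∷ Π) = guarded (λ ρ → does (ρ ⋖? π)) (does (isFinalChain? (π ∷ Π))) _ (λ ρ → weight (ρ ∷ π ∷ Π)) $ begin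
    ∑ (allNC n) (λ ρ → if does (ρ ⋖? π) then weight (ρ ∷ π ∷ Π) else 0ₚ)
      ≈⟨ ∑-filter (_⋖? π) _ (allNC n) ⟨
    ∑ (filter (_⋖? π) (allNC n)) (λ ρ → weight (ρ ∷ π ∷ Π))
      ≈⟨ ∑-cong (filter (_⋖? π) (allNC n)) (λ _ → ≈-trans (*-congʳ (*ₚ-comm _ _)) (*ₚ-assoc _ _ _)) ⟩
    ∑ (filter (_⋖? π) (allNC n)) (λ ρ → wt (π ∷ Π) *ₚ ((if does (ρ ⊏? π) then 1ₚ else w) *ₚ f (type ρ)))
      ≈⟨ ∑-*ˡ (wt (π ∷ Π)) _ (filter (_⋖? π) (allNC n)) ⟩
    wt (π ∷ Π) *ₚ ∑ (filter (_⋖? π) (allNC n)) (λ ρ → (if does (ρ ⊏? π) then 1ₚ else w) *ₚ f (type ρ))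
      ≈⟨ *-congˡ (∑-covers π w f-sym) ⟩
    wt (π ∷ Π) *ₚ splits w f (type π) ∎

-- Induction on the length of chains

1/n*n≈1 : ∀ n .{{_ : NonZero n}} → con (+ 1 / n) *ₚ natₚ n ≈ 1ₚ
1/n*n≈1 n = ≈-trans (≈-sym (con-* _ _)) (reflexive (cong con (1/n*n≡1 n)))

natₚ-cancelˡ : ∀ n .{{_ : NonZero n}} {p q} → natₚ n *ₚ p ≈ natₚ n *ₚ q → p ≈ q
natₚ-cancelˡ n {p} {q} np≈nq = begin
  p                                 ≈⟨ divide p ⟨
  con (+ 1 / n) *ₚ (natₚ n *ₚ p)    ≈⟨ *-congˡ np≈nq ⟩
  con (+ 1 / n) *ₚ (natₚ n *ₚ q)    ≈⟨ divide q ⟩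
  q                                 ∎
  where
  divide : ∀ p → con (+ 1 / n) *ₚ (natₚ n *ₚ p) ≈ p
  divide p = ≈-trans (≈-sym (*ₚ-assoc _ _ _)) (≈-trans (*-congʳ (1/n*n≈1 n)) (*ₚ-identityˡ p))

⋯⟩-∷ : ∀ {a b} → a ℕ.< b → [ a ⋯ b ⟩ ≡ a ∷ [ suc a ⋯ b ⟩
⋯⟩-∷ {a} {b} a<b = trans (cong (applyUpTo (a ℕ.+_)) (ℕ.+-∸-assoc 1 a<b))
  (cong₂ _∷_ (ℕ.+-identityʳ a) (applyUpTo-cong (ℕ.+-suc a) (b ∸ suc a)))
  where
  applyUpTo-cong : ∀ {f g : ℕ → ℕ} → (∀ i → f i ≡ g i) → ∀ m → applyUpTo f m ≡ applyUpTo g m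
  applyUpTo-cong eq zero    = refl
  applyUpTo-cong eq (suc m) = cong₂ _∷_ (eq 0) (applyUpTo-cong (λ i → eq (suc i)) m)

factor : ℕ → ℕ → ℚ[X]
factor n i = natₚ i *ₚ X i +ₚ natₚ (n ∸ i)

∑-chains-compositions : ∀ n k → k ℕ.≤ n → ∀ {f} → Symmetric f →
  natₚ (suc k) *ₚ ∑-chains (suc n) k f ≈
  ∏ [ n ∸ k ⋯ n ⟩ (factor (suc n)) *ₚ ∑₊ (n ∸ k) (suc k) f
∑-chains-compositions n zero _ {f} f-sym = begin
  1ₚ *ₚ ∑-chains (suc n) 0 f
    ≈⟨ *-congˡ (∑-chains-zero n f-sym) ⟩
  1ₚ *ₚ f (n ∷ [])
    ≈⟨ *-congˡ (∑₊-one f n) ⟨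
  1ₚ *ₚ ∑₊ n 1 f
    ≡⟨ cong (λ m → ∏ (applyUpTo (n ℕ.+_) m) (factor (suc n)) *ₚ ∑₊ n 1 f) (sym (ℕ.n∸n≡0 n)) ⟩
  ∏ [ n ⋯ n ⟩ (factor (suc n)) *ₚ ∑₊ n 1 f ∎
-- The induction hypothesis needs the factor k + 1 on the left, and `∑₊-splits-mean` returns the
-- same factor on the right, where it is cancelled.
∑-chains-compositions n (suc k) k<n {f} f-sym = natₚ-cancelˡ (suc k) $ begin
  natₚ (suc k) *ₚ (natₚ (suc (suc k)) *ₚ ∑-chains (suc n) (suc k) f)
    ≈⟨ *-congˡ (*-congˡ (∑-chains-suc (suc n) k f-sym)) ⟩
  natₚ (suc k) *ₚ (natₚ (suc (suc k)) *ₚ ∑-chains (suc n) k (splits (X a) f))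
    ≈⟨ *ₚ-x∙yz≈y∙xz _ _ _ ⟩
  natₚ (suc (suc k)) *ₚ (natₚ (suc k) *ₚ ∑-chains (suc n) k (splits (X a) f))
    ≈⟨ *-congˡ (∑-chains-compositions n k (ℕ.<⇒≤ k<n) (splits-symmetric f-sym)) ⟩
  natₚ (suc (suc k)) *ₚ (∏ [ n ∸ k ⋯ n ⟩ (factor (suc n)) *ₚ ∑₊ (n ∸ k) (suc k) (splits (X a) f))
    ≡⟨ cong (λ m → natₚ (suc (suc k)) *ₚ (∏ [ m ⋯ n ⟩ (factor (suc n)) *ₚ ∑₊ m (suc k) (splits (X a) f))) n∸k ⟩
  natₚ (suc (suc k)) *ₚ (P *ₚ ∑₊ (suc a) (suc k) (splits (X a) f))
    ≈⟨ *ₚ-x∙yz≈y∙xz _ _ _ ⟩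
  P *ₚ (natₚ (suc (suc k)) *ₚ ∑₊ (suc a) (suc k) (splits (X a) f))
    ≈⟨ *-congˡ (∑₊-splits-mean f-sym a k) ⟩
  P *ₚ (natₚ (suc k) *ₚ ((natₚ a *ₚ X a +ₚ natₚ (suc (suc k))) *ₚ ∑₊ a (suc (suc k)) f))
    ≈⟨ *ₚ-x∙yz≈y∙xz _ _ _ ⟩
  natₚ (suc k) *ₚ (P *ₚ ((natₚ a *ₚ X a +ₚ natₚ (suc (suc k))) *ₚ ∑₊ a (suc (suc k)) f))
    ≈⟨ *-congˡ (≈-trans (≈-sym (*ₚ-assoc _ _ _)) (*-congʳ (*ₚ-comm _ _))) ⟩
  natₚ (suc k) *ₚ ((natₚ a *ₚ X a +ₚ natₚ (suc (suc k))) *ₚ P *ₚ ∑₊ a (suc (suc k)) f)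
    -- The number k + 2 of parts is the constant n - i of the factor with i = `a`, where n stands
    -- for `suc n`.
    ≡⟨ cong (λ m → natₚ (suc k) *ₚ ((natₚ a *ₚ X a +ₚ natₚ m) *ₚ P *ₚ ∑₊ a (suc (suc k)) f)) (sym 1+n∸a) ⟩
  natₚ (suc k) *ₚ (factor (suc n) a *ₚ P *ₚ ∑₊ a (suc (suc k)) f)
    ≡⟨ cong (λ l → natₚ (suc k) *ₚ (∏ l (factor (suc n)) *ₚ ∑₊ a (suc (suc k)) f)) (sym (⋯⟩-∷ a<n)) ⟩
  natₚ (suc k) *ₚ (∏ [ a ⋯ n ⟩ (factor (suc n)) *ₚ ∑₊ a (suc (suc k)) f) ∎
  where
  a : ℕ
  a = n ∸ suc k

  P : ℚ[X]
  P = ∏ [ suc a ⋯ n ⟩ (factor (suc n))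

  n∸k : n ∸ k ≡ suc a
  n∸k = ℕ.+-∸-assoc 1 k<n

  a<n : a ℕ.< n
  a<n = ℕ.≤-trans (ℕ.≤-reflexive (sym n∸k)) (ℕ.m∸n≤m n k)

  1+n∸a : suc n ∸ a ≡ suc (suc k)
  1+n∸a = trans (ℕ.+-∸-assoc 1 (ℕ.<⇒≤ a<n)) (cong suc (ℕ.m∸[m∸n]≡n k<n))

corollary17 : (n k : ℕ) .{{_ : NonZero n}} → 1 ℕ.≤ k → k ℕ.≤ n →
    ∑[ Π ∈ finalChains n k ] wt Π
    ≈ con (+ 1 / n) *ₚ natₚ (n C k)
    *ₚ (∏[ i ∈ [ n ∸ k ⋯ n ∸ 1 ⟩ ] (natₚ i *ₚ X i +ₚ natₚ (n ∸ i)))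
corollary17 (suc n) (suc k) _ (ℕ.s≤s k≤n) = natₚ-cancelˡ (suc k) $ begin
  natₚ (suc k) *ₚ ∑ (finalChains (suc n) (suc k)) wt
    ≈⟨ *-congˡ (∑-cong (finalChains (suc n) (suc k)) (λ _ → ≈-sym (*-identityʳ _))) ⟩
  natₚ (suc k) *ₚ ∑-chains (suc n) k (λ _ → 1ₚ)
    ≈⟨ ∑-chains-compositions n k k≤n (λ _ → ≈-refl) ⟩
  P *ₚ ∑₊ (n ∸ k) (suc k) (λ _ → 1ₚ)
    ≈⟨ *-congˡ (∑₊-1 (n ∸ k) k) ⟩
  P *ₚ natₚ ((n ∸ k + k) C k)
    ≡⟨ cong (λ m → P *ₚ natₚ (m C k)) (ℕ.m∸n+n≡m k≤n) ⟩
  P *ₚ natₚ (n C k)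
    ≈⟨ *ₚ-comm _ _ ⟩
  natₚ (n C k) *ₚ P
    ≈⟨ *-congʳ coefficient ⟩
  natₚ (suc k) *ₚ (con (+ 1 / suc n) *ₚ natₚ (suc n C suc k)) *ₚ P
    ≈⟨ *ₚ-assoc _ _ _ ⟩
  natₚ (suc k) *ₚ (con (+ 1 / suc n) *ₚ natₚ (suc n C suc k) *ₚ P) ∎
  where
  P : ℚ[X]
  P = ∏ [ n ∸ k ⋯ n ⟩ (factor (suc n))

  -- With n and k lowered by one, this is the passage from the number of compositions to the
  -- coefficient of the theorem, still multiplied by the number of blocks that is cancelled at the
  -- end.
  coefficient : natₚ (n C k) ≈ natₚ (suc k) *ₚ (con (+ 1 / suc n) *ₚ natₚ (suc n C suc k))
  coefficient = begin
    natₚ (n C k)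
      ≈⟨ ≈-trans (*-congʳ (1/n*n≈1 (suc n))) (*ₚ-identityˡ _) ⟨
    con (+ 1 / suc n) *ₚ natₚ (suc n) *ₚ natₚ (n C k)
      ≈⟨ *ₚ-assoc _ _ _ ⟩
    con (+ 1 / suc n) *ₚ (natₚ (suc n) *ₚ natₚ (n C k))
      ≈⟨ *-congˡ (natₚ-* (suc n) (n C k)) ⟨
    con (+ 1 / suc n) *ₚ natₚ (suc n * (n C k))
      ≡⟨ cong (λ m → con (+ 1 / suc n) *ₚ natₚ m) (sym (absorption n k)) ⟩
    con (+ 1 / suc n) *ₚ natₚ (suc k * (suc n C suc k))
      ≈⟨ *-congˡ (natₚ-* (suc k) (suc n C suc k)) ⟩
    con (+ 1 / suc n) *ₚ (natₚ (suc k) *ₚ natₚ (suc n C suc k))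
      ≈⟨ *ₚ-x∙yz≈y∙xz _ _ _ ⟩
    natₚ (suc k) *ₚ (con (+ 1 / suc n) *ₚ natₚ (suc n C suc k)) ∎
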